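{- For every integer $d\ge 0$, $$E_d = \sum_{\delta \in \mathrm{PCom}_{\mathrm{sqf}}(d)} (-1)^{\ell(\delta)}\frac{P_\delta}{Z_\delta}.$$
   Context: A composition of $n\ge 0$ is a finite tuple $\alpha=(\alpha_1,\dots,\alpha_l)$ of positive integers with sum $n$; $\ell(\alpha)=l$; the empty composition is the only composition of $0$. A polycomposition of $n$ is a sequence $\delta=(\alpha^{(1)},\alpha^{(2)},\dots)$ of (possibly empty) compositions with $\sum_{i\ge1} i|\alpha^{(i)}|=n$; write formally (not exponentiation) $\delta=(\alpha^{(1)})^1(\alpha^{(2)})^2\cdots$, omitting empty compositions. Its length is $\ell(\delta)=\sum_i\ell(\alpha^{(i)})$. Each part $d$ of $\alpha^{(r)}$ gives a block $d^r$ of $\delta$. $\mathrm{PCom}_{\mathrm{sqf}}(d)$ is the set of square-free polycompositions of $d$: those of the form $(\alpha)^1$ with $\alpha$ a composition of $d$. For a composition $\alpha=(\alpha_1,\dots,\alpha_l)$ put $Z_\alpha=\alpha_1(\alpha_1+\alpha_2)(\alpha_1+\alpha_2+\alpha_3)\cdots(\alpha_1+\cdots+\alpha_l)$ (equal to $1$ for the empty composition), and for $\delta=(\alpha)^1$ put $Z_\delta=Z_\alpha$. Let $x_{i,j}$ ($i,j\ge 1$) be indeterminates with $\deg x_{i,j}=i$; all series have rational coefficients. A monomial is square-free if every exponent is at most $1$. $E_d$ is the sum over square-free monomials $f$ of degree $d$ of $(-1)^{m(f)}f$, where $m(f)$ is the number of indeterminates in $f$ (so $E_0=1$). For $d\ge1$,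 $P_d=\sum_{k\mid d}\sum_{j\ge1} k\,x_{k,j}^{d/k}$, with $k$ ranging over positive divisors of $d$. For a block $d^r$, $P_{d^r}$ is obtained from $P_d$ by replacing each $x_{i,j}$ by $x_{i,j}^r$, and $P_\delta=\prod P_{d^r}$ over all blocks $d^r$ of $\delta$ (counted with repetition; empty product $=1$). -}

module Defs where

open import Data.Bool.Base using (if_then_else_)
open import Data.Empty using (⊥)
open import Data.Integer.Base as ℤ using (ℤ; +_; -1ℤ)
open import Data.List.Base
  using (List; []; _∷_; [_]; _∷ʳ_; _++_; map; foldr; length; concat; filter;
         replicate; upTo; cartesianProductWith; initLast; _∷ʳ′_)
open import Data.List.Extrema.Nat using (max)
open import Data.List.Membership.Propositional using (_∈_)
open import Data.List.Membership.Propositional.Properties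
  using (∈-map⁺; ∈-map⁻; ∈-++⁺ˡ; ∈-++⁺ʳ; ∈-++⁻)
open import Data.List.Properties using (∷ʳ-injectiveˡ; ∷ʳ-injectiveʳ)
open import Data.List.Relation.Unary.All as All using (All; []; _∷_)
open import Data.List.Relation.Unary.Any using (here)
open import Data.List.Relation.Unary.Unique.Propositional using (Unique; []; _∷_)
import Data.List.Relation.Unary.Unique.Propositional.Properties as Unique
open import Data.Nat.Base as ℕ
  using (ℕ; zero; suc; NonZero; _+_; _*_; _∸_; _≤_; s≤s; z≤n)
open import Data.Nat.Divisibility using (_∣?_)
open import Data.Nat.DivMod using (_/_)
open import Data.Nat.ListAction using (sum)
import Data.Nat.Properties as ℕ
open import Data.Product.Base using (∃; ∃-syntax; _×_; _,_)
open import Data.Rational.Base as ℚ using (ℚ; 0ℚ; 1ℚ)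
open import Data.Sum.Base using (inj₁; inj₂)
open import Function.Base using (case_of_)
open import Function.Bundles using (_⇔_; mk⇔; Equivalence)
open import Relation.Binary.PropositionalEquality
  using (_≡_; refl; sym; trans; cong; subst)
open import Relation.Nullary.Decidable using (Dec; does; _×-dec_)
open import Relation.Nullary.Negation using (contradiction)

record ℕ⁺ : Set where
  constructor pos
  field
    val          : ℕ
    .{{nonZero}} : NonZero val

open ℕ⁺ public

1⁺ : ℕ⁺
1⁺ = pos 1

suc⁺ : ℕ⁺ → ℕ⁺
suc⁺ k = pos (suc (val k))

-- [1, …, n]
range⁺ : ℕ → List ℕ⁺
range⁺ n = map (λ k → pos (suc k)) (upTo n)

infixl 6 _+⁺_
infixl 7 _*⁺_ _/⁺_

_+⁺_ : ℕ → ℕ⁺ → ℕ⁺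
s +⁺ a = pos (s + val a) {{nz s a}}
  where
  nz : ∀ s (a : ℕ⁺) → NonZero (s + val a)
  nz s (pos (suc a)) = subst NonZero (sym (ℕ.+-suc s a)) _

_*⁺_ : ℕ⁺ → ℕ⁺ → ℕ⁺
pos a *⁺ pos b = pos (a * b) {{ℕ.m*n≢0 a b}}

_/⁺_ : ℤ → ℕ⁺ → ℚ
i /⁺ pos n = i ℚ./ n

Composition : Set
Composition = List ℕ⁺

∣_∣ : Composition → ℕ
∣ α ∣ = sum (map val α)

-- Z-from s α = (s + α₁)(s + α₁ + α₂)⋯(s + α₁ + ⋯ + α_l)
Z-from : ℕ → Composition → ℕ⁺
Z-from s []      = 1⁺
Z-from s (a ∷ α) = (s +⁺ a) *⁺ Z-from (s + val a) α

Z : Composition → ℕ⁺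
Z = Z-from 0

-- Each composition of val k + n whose last part is at least k, once: its last
-- part is either exactly k, preceded by a composition of n, or at least k + 1.
compositions-from : ℕ⁺ → ℕ → List Composition
compositions-from k zero    = [ [ k ] ]
compositions-from k (suc n) =
  map (_∷ʳ k) (compositions-from 1⁺ n) ++ compositions-from (suc⁺ k) n

compositions : ℕ → List Composition
compositions zero    = [ [] ]
compositions (suc n) = compositions-from 1⁺ n

∣∷ʳ∣ : ∀ α a → ∣ α ∷ʳ a ∣ ≡ ∣ α ∣ + val a
∣∷ʳ∣ []      a = ℕ.+-comm (val a) 0
∣∷ʳ∣ (b ∷ α) a =
  trans (cong (λ n → val b + n) (∣∷ʳ∣ α a)) (sym (ℕ.+-assoc (val b) ∣ α ∣ (val a)))

∣∣-∷ʳ-injective : ∀ α a {n} → ∣ α ∷ʳ a ∣ ≡ val a + n → ∣ α ∣ ≡ n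
∣∣-∷ʳ-injective α a {n} eq = ℕ.+-cancelˡ-≡ (val a) ∣ α ∣ n
  (trans (ℕ.+-comm (val a) ∣ α ∣) (trans (sym (∣∷ʳ∣ α a)) eq))

compositions-from-sound : ∀ k n {α} → α ∈ compositions-from k n → ∣ α ∣ ≡ val k + n
compositions-from-sound k zero    (here refl) = refl
compositions-from-sound k (suc n) α∈ with ∈-++⁻ (map (_∷ʳ k) (compositions-from 1⁺ n)) α∈
... | inj₂ α∈ʳ = trans (compositions-from-sound (suc⁺ k) n α∈ʳ) (sym (ℕ.+-suc (val k) n))
... | inj₁ α∈ˡ with ∈-map⁻ (_∷ʳ k) α∈ˡ
...   | β , β∈ , refl = trans (∣∷ʳ∣ β k)
        (trans (cong (_+ val k) (compositions-from-sound 1⁺ n β∈)) (ℕ.+-comm (suc n) (val k)))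

compositions-from-last : ∀ k n {α} → α ∈ compositions-from k n →
                         ∃[ β ] ∃[ a ] α ≡ β ∷ʳ a × val k ≤ val a
compositions-from-last k zero    (here refl) = [] , k , refl , ℕ.≤-refl
compositions-from-last k (suc n) α∈ with ∈-++⁻ (map (_∷ʳ k) (compositions-from 1⁺ n)) α∈
... | inj₁ α∈ˡ with ∈-map⁻ (_∷ʳ k) α∈ˡ
...   | β , _ , refl = β , k , refl , ℕ.≤-refl
compositions-from-last k (suc n) α∈ | inj₂ α∈ʳ with compositions-from-last (suc⁺ k) n α∈ʳ
...   | β , a , eq , k<a = β , a , eq , ℕ.<⇒≤ k<a

compositions-from-complete : ∀ k n β a → val k ≤ val a → ∣ β ∷ʳ a ∣ ≡ val k + n →
                             β ∷ʳ a ∈ compositions-from k n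
compositions-from-complete k n β a k≤a eq with ℕ.m≤n⇒m<n∨m≡n k≤a
compositions-from-complete k zero β a _ eq | inj₁ k<a = contradiction
  (subst (val a ≤_) (trans (sym (∣∷ʳ∣ β a)) (trans eq (ℕ.+-identityʳ (val k))))
    (ℕ.m≤n+m (val a) ∣ β ∣))
  (ℕ.<⇒≱ k<a)
compositions-from-complete k (suc n) β a _ eq | inj₁ k<a =
  ∈-++⁺ʳ (map (_∷ʳ k) (compositions-from 1⁺ n))
    (compositions-from-complete (suc⁺ k) n β a k<a (trans eq (ℕ.+-suc (val k) n)))
compositions-from-complete k zero [] a _ eq | inj₂ refl = here refl
compositions-from-complete k zero (pos (suc _) ∷ β) a _ eq | inj₂ refl =
  contradiction (∣∣-∷ʳ-injective (_ ∷ β) a eq) λ ()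
compositions-from-complete k (suc n) β a _ eq | inj₂ refl with initLast β
... | []            = contradiction (∣∣-∷ʳ-injective [] a eq) λ ()
... | γ ∷ʳ′ pos (suc b) = ∈-++⁺ˡ (∈-map⁺ (_∷ʳ k)
        (compositions-from-complete 1⁺ n γ (pos (suc b)) (s≤s z≤n)
          (∣∣-∷ʳ-injective (γ ∷ʳ pos (suc b)) a eq)))

compositions-from-unique : ∀ k n → Unique (compositions-from k n)
compositions-from-unique k zero    = [] ∷ []
compositions-from-unique k (suc n) = Unique.++⁺
  (Unique.map⁺ (λ {α} {β} → ∷ʳ-injectiveˡ α β) (compositions-from-unique 1⁺ n))
  (compositions-from-unique (suc⁺ k) n)
  disjoint
  where
  disjoint : ∀ {α} → α ∈ map (_∷ʳ k) (compositions-from 1⁺ n) ×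
                     α ∈ compositions-from (suc⁺ k) n → ⊥
  disjoint (α∈ˡ , α∈ʳ)
    with ∈-map⁻ (_∷ʳ k) α∈ˡ | compositions-from-last (suc⁺ k) n α∈ʳ
  ... | β , _ , refl | γ , a , eq , k<a with ∷ʳ-injectiveʳ β γ eq
  ...   | refl = ℕ.<-irrefl refl k<a

∈-compositions : ∀ d {α} → α ∈ compositions d ⇔ ∣ α ∣ ≡ d
∈-compositions d = mk⇔ (sound d) (complete d _)
  where
  sound : ∀ d {α} → α ∈ compositions d → ∣ α ∣ ≡ d
  sound zero    (here refl) = refl
  sound (suc n) α∈          = compositions-from-sound 1⁺ n α∈

  complete : ∀ d α → ∣ α ∣ ≡ d → α ∈ compositions d
  complete zero    []              _  = here refl
  complete zero    (pos (suc _) ∷ _) ()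
  complete (suc n) α eq with initLast α
  ... | β ∷ʳ′ pos (suc a) =
    compositions-from-complete 1⁺ n β (pos (suc a)) (s≤s z≤n) eq

compositions-unique : ∀ d → Unique (compositions d)
compositions-unique zero    = [] ∷ []
compositions-unique (suc n) = compositions-from-unique 1⁺ n

-- The sequence (α⁽¹⁾, α⁽²⁾, …), cut off somewhere past its last nonempty entry.
Polycomposition : Set
Polycomposition = List Composition

ℓ : Polycomposition → ℕ
ℓ δ = sum (map length δ)

weight-from : ℕ → Polycomposition → ℕ
weight-from i []      = 0
weight-from i (α ∷ δ) = i * ∣ α ∣ + weight-from (suc i) δ

-- δ is a polycomposition of weight δ.
weight : Polycomposition → ℕ
weight = weight-from 1

-- (d , r) is the block dʳ.
Block : Set
Block = ℕ⁺ × ℕ⁺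

blocks-from : ℕ⁺ → Polycomposition → List Block
blocks-from r []      = []
blocks-from r (α ∷ δ) = map (_, r) α ++ blocks-from (suc⁺ r) δ

blocks : Polycomposition → List Block
blocks = blocks-from 1⁺

data SquareFree : Polycomposition → Set where
  ⟨_⟩¹ : ∀ α → SquareFree (α ∷ [])

Zδ : ∀ {δ} → SquareFree δ → ℕ⁺
Zδ ⟨ α ⟩¹ = Z α

PComSqf : ℕ → List (∃ SquareFree)
PComSqf d = map (λ α → α ∷ [] , ⟨ α ⟩¹) (compositions d)

weight-⟨⟩¹ : ∀ α → weight (α ∷ []) ≡ ∣ α ∣
weight-⟨⟩¹ α = trans (ℕ.+-identityʳ (1 * ∣ α ∣)) (ℕ.*-identityˡ ∣ α ∣)

∈-PComSqf : ∀ d {δ} (sf : SquareFree δ) → (δ , sf) ∈ PComSqf d ⇔ weight δ ≡ d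
∈-PComSqf d ⟨ α ⟩¹ = mk⇔
  (λ δ∈ → case ∈-map⁻ _ δ∈ of λ where
    (β , β∈ , refl) → trans (weight-⟨⟩¹ β) (to β∈))
  (λ eq → ∈-map⁺ _ (from (trans (sym (weight-⟨⟩¹ α)) eq)))
  where open Equivalence (∈-compositions d {α}) using (to; from)

-- The i-th row lists the exponents of x_{i,1}, x_{i,2}, …; all exponents that
-- are not listed are 0.  One monomial thus has many representatives, which
-- differ in trailing zeros and trailing rows of zeros.
Row Monomial : Set
Row      = List ℕ
Monomial = List Row

ZeroRow : Row → Set
ZeroRow = All (_≡ 0)

zeroRow? : ∀ r → Dec (ZeroRow r)
zeroRow? = All.all? (ℕ._≟ 0)

infix 4 _≈ʳ_ _≈ʳ?_ _≈ᵐ_ _≈ᵐ?_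

_≈ʳ_ : Row → Row → Set
[]      ≈ʳ s       = ZeroRow s
(a ∷ r) ≈ʳ []      = ZeroRow (a ∷ r)
(a ∷ r) ≈ʳ (b ∷ s) = a ≡ b × r ≈ʳ s

_≈ʳ?_ : ∀ r s → Dec (r ≈ʳ s)
[]      ≈ʳ? s       = zeroRow? s
(a ∷ r) ≈ʳ? []      = zeroRow? (a ∷ r)
(a ∷ r) ≈ʳ? (b ∷ s) = (a ℕ.≟ b) ×-dec (r ≈ʳ? s)

_≈ᵐ_ : Monomial → Monomial → Set
[]      ≈ᵐ n       = All ZeroRow n
(r ∷ m) ≈ᵐ []      = All ZeroRow (r ∷ m)
(r ∷ m) ≈ᵐ (s ∷ n) = r ≈ʳ s × m ≈ᵐ n

_≈ᵐ?_ : ∀ m n → Dec (m ≈ᵐ n)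
[]      ≈ᵐ? n       = All.all? zeroRow? n
(r ∷ m) ≈ᵐ? []      = All.all? zeroRow? (r ∷ m)
(r ∷ m) ≈ᵐ? (s ∷ n) = (r ≈ʳ? s) ×-dec (m ≈ᵐ? n)

1ᵐ : Monomial
1ᵐ = []

-- x[ i , j ]^ e is the monomial x_{i,j}ᵉ.
x[_,_]^_ : ℕ⁺ → ℕ⁺ → ℕ → Monomial
x[ i , j ]^ e =
  replicate (ℕ.pred (val i)) [] ∷ʳ (replicate (ℕ.pred (val j)) 0 ∷ʳ e)

deg-from : ℕ → Monomial → ℕ
deg-from i []      = 0
deg-from i (r ∷ m) = i * sum r + deg-from (suc i) m

-- deg x_{i,j} = i
deg : Monomial → ℕ
deg = deg-from 1

SquareFreeᵐ : Monomial → Set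
SquareFreeᵐ = All (All (_≤ 1))

squareFreeᵐ? : ∀ m → Dec (SquareFreeᵐ m)
squareFreeᵐ? = All.all? (All.all? (ℕ._≤? 1))

-- The number of indeterminates occurring in a monomial.
#vars : Monomial → ℕ
#vars m = length (filter (1 ℕ.≤?_) (concat m))

-- An upper bound for all j such that some x_{i,j} occurs.
width : Monomial → ℕ
width m = max 0 (map length m)

splitsℕ : ℕ → List (ℕ × ℕ)
splitsℕ n = map (λ a → a , n ∸ a) (upTo (suc n))

splitsᴸ : {A : Set} → (A → List (A × A)) → List A → List (List A × List A)
splitsᴸ s []       = [ [] , [] ]
splitsᴸ s (x ∷ xs) =
  cartesianProductWith (λ (a , b) (as , bs) → a ∷ as , b ∷ bs)
    (s x) (splitsᴸ s xs)

-- All factorisations of a monomial into two monomials, each once; the factors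
-- have the same shape as the given representative.
splits : Monomial → List (Monomial × Monomial)
splits = splitsᴸ (splitsᴸ splitsℕ)

-- Formal power series over ℚ, as coefficient functions.  E, P and the
-- operations below yield the same coefficient at all representatives of a monomial.
Series : Set
Series = Monomial → ℚ

infix  4 _≈_
infixl 7 _·_ _⊛_

_≈_ : Series → Series → Set
f ≈ g = ∀ m → f m ≡ g m

fromℕ : ℕ → ℚ
fromℕ n = + n ℚ./ 1

sumℚ : List ℚ → ℚ
sumℚ = foldr ℚ._+_ 0ℚ

∑ : {A : Set} → List A → (A → Series) → Series
∑ xs f m = sumℚ (map (λ x → f x m) xs)

-- The sum of f j over all j ≥ 1, for families such that every monomial of f j
-- involves some x_{i,j}: the terms with j > width m do not contribute to the
-- coefficient of m.
∑∞ : (ℕ⁺ → Series) → Series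
∑∞ f m = ∑ (range⁺ (width m)) f m

⟦_⟧ : Monomial → Series
⟦ n ⟧ m = if does (m ≈ᵐ? n) then 1ℚ else 0ℚ

1ˢ : Series
1ˢ = ⟦ 1ᵐ ⟧

_·_ : ℚ → Series → Series
(c · f) m = c ℚ.* f m

_⊛_ : Series → Series → Series
(f ⊛ g) m = sumℚ (map (λ (a , b) → f a ℚ.* g b) (splits m))

∏ : {A : Set} → List A → (A → Series) → Series
∏ xs f = foldr _⊛_ 1ˢ (map f xs)

-- f ⟨x^ r ⟩ is f with each x_{i,j} replaced by x_{i,j}ʳ: the coefficient of m
-- is nonzero only if m is an r-th power.
_⟨x^_⟩ : Series → ℕ⁺ → Series
(f ⟨x^ r ⟩) m =
  if does (All.all? (All.all? (val r ∣?_)) m)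
  then f (map (map (λ e → e / val r)) m)
  else 0ℚ

E : ℕ → Series
E d f =
  if does (squareFreeᵐ? f ×-dec (deg f ℕ.≟ d))
  then (-1ℤ ℤ.^ #vars f) ℚ./ 1
  else 0ℚ

divisors : ℕ⁺ → List ℕ⁺
divisors d = filter (λ k → val k ∣? val d) (range⁺ (val d))

P : ℕ⁺ → Series
P d = ∑ (divisors d) λ k → ∑∞ λ j →
  fromℕ (val k) · ⟦ x[ k , j ]^ (val d / val k) ⟧

P-block : Block → Series
P-block (d , r) = P d ⟨x^ r ⟩

Pδ : Polycomposition → Series
Pδ δ = ∏ (blocks δ) P-block

{-# OPTIONS --safe #-}

-- Let ε be the sum of all E d with d ≥ 0, and p the sum of all P d with d ≥ 1.
-- Then ε = ∏ (1 − x_{i,j}), and the logarithmic derivative of ε with respect to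
-- the degree derivation f ↦ deg f · f is −p; comparing the parts of degree d
-- gives Newton's identity d E_d = − ∑_{k = 1}^{d} E_{d−k} P_k.  Since the last
-- factor of Z_α is |α|, splitting off the last part k of α shows that the
-- right-hand side of the theorem satisfies the same recursion.
module Submission where

open import Defs
open import Algebra.Bundles using (CommutativeMonoid)
import Algebra.Properties.CommutativeSemigroup as CommutativeSemigroup
open import Data.Bool.Base using (Bool; true; false; _∧_; if_then_else_)
open import Data.Empty using (⊥-elim)
open import Data.Integer.Base as ℤ using (-1ℤ)
import Data.Integer.Properties as ℤ
open import Data.Integer.Tactic.RingSolver using () renaming (solve-∀ to ℤ-solve-∀)
open import Data.List.Base
  using (List; []; _∷_; _∷ʳ_; _++_; map; length; concat; filter; replicate; upTo;
         cartesianProductWith)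
open import Data.List.Extrema.Nat using (xs≤max)
open import Data.List.Membership.Propositional using (_∈_)
open import Data.List.Properties
  using (filter-++; length-++; map-id; map-∘; map-cong; map-upTo; map-applyUpTo)
open import Data.List.Relation.Unary.All as All using (All; []; _∷_)
import Data.List.Relation.Unary.All.Properties as All
open import Data.List.Relation.Unary.Any using (here; there)
open import Data.Nat.Base as ℕ using (ℕ; zero; suc; _∸_; _≤_; _<_; s≤s; z≤n)
open import Data.Nat.Divisibility using (_∣_; _∣?_; divides; 1∣_)
open import Data.Nat.DivMod using (m*n/n≡m; n/1≡n)
open import Data.Nat.ListAction using (sum)
import Data.Nat.Properties as ℕ
open import Data.Nat.Tactic.RingSolver using () renaming (solve-∀ to ℕ-solve-∀)
open import Data.Product.Base using (_×_; _,_)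
open import Data.Rational.Base as ℚ using (ℚ; 0ℚ; 1ℚ; _+_; _*_; -_; _/_; toℚᵘ)
open import Data.Rational.Properties as ℚ
  using (toℚᵘ-injective; toℚᵘ-homo-*; toℚᵘ-homo-+; toℚᵘ-fromℚᵘ)
open import Data.Rational.Unnormalised.Base using (mkℚᵘ; *≡*; _≃_)
import Data.Rational.Unnormalised.Properties as ℚᵘ
open import Data.Sum.Base using (inj₁; inj₂)
open import Function.Base using (_∘_; id)
open import Function.Bundles using (mk⇔; Equivalence)
open import Relation.Binary.PropositionalEquality
  using (_≡_; refl; sym; trans; cong; cong₂; subst; module ≡-Reasoning)
open import Relation.Nullary.Decidable
  using (Dec; does; yes; no; _×-dec_; dec⇒maybe; dec-true; dec-false; does-⇔)
open import Relation.Nullary.Negation using (¬_)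
open import Tactic.RingSolver using (solve-∀)
open import Tactic.RingSolver.Core.AlmostCommutativeRing
  using (AlmostCommutativeRing; fromCommutativeRing)

open ≡-Reasoning
open CommutativeSemigroup (CommutativeMonoid.commutativeSemigroup ℚ.+-0-commutativeMonoid)
  using () renaming (interchange to +-interchange)
open CommutativeSemigroup (CommutativeMonoid.commutativeSemigroup ℚ.*-1-commutativeMonoid)
  using () renaming (interchange to *-interchange)

-- A coefficient of a product is a sum over the factorisations of a list of lists of exponents. This
-- factorisation is the coproduct of a graded coalgebra, and it arises from the splittings of a
-- single exponent by applying one list construction twice: to rows, then to monomials. Hence the
-- laws of convolution and the logarithmic derivative are proved for one indeterminate and lifted.
-- The infinite product raises no question of convergence: a representative lists finitely many
-- exponents, and every factor has constant coefficient 1. The laborious part is to recognise `P d`: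
-- it is defined through the divisors of `d` and a bound on `j`, whereas `p` recurses along the list
-- of rows. The enumeration of compositions recurses on a lower bound `k` for the last part. The
-- induction therefore runs over truncated Newton sums `EP n k`, with the factor `d` multiplied
-- through and cancelled only at the end.

ℚ-ring : AlmostCommutativeRing _ _
ℚ-ring = fromCommutativeRing ℚ.+-*-commutativeRing λ p → dec⇒maybe (0ℚ ℚ.≟ p)

private variable
  A B C : Set

-- Fractions with integer numerators

toℚᵘ-/ : ∀ i n → toℚᵘ (i / suc n) ≃ mkℚᵘ i n
toℚᵘ-/ i n = toℚᵘ-fromℚᵘ (mkℚᵘ i n)

-- Since `_/_` reduces to lowest terms, the identity is checked on unnormalised fractions, where
-- equality is cross-multiplication.
/1-homo-* : ∀ i j → (i / 1) * (j / 1) ≡ (i ℤ.* j) / 1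
/1-homo-* i j = toℚᵘ-injective
  (ℚᵘ.≃-trans (toℚᵘ-homo-* (i / 1) (j / 1))
  (ℚᵘ.≃-trans (ℚᵘ.*-cong (toℚᵘ-/ i 0) (toℚᵘ-/ j 0))
              (ℚᵘ.≃-sym (toℚᵘ-/ (i ℤ.* j) 0))))

/1-homo-+ : ∀ i j → (i / 1) + (j / 1) ≡ (i ℤ.+ j) / 1
/1-homo-+ i j = toℚᵘ-injective
  (ℚᵘ.≃-trans (toℚᵘ-homo-+ (i / 1) (j / 1))
  (ℚᵘ.≃-trans (ℚᵘ.+-cong (toℚᵘ-/ i 0) (toℚᵘ-/ j 0))
  (ℚᵘ.≃-trans (*≡* (eq i j)) (ℚᵘ.≃-sym (toℚᵘ-/ (i ℤ.+ j) 0)))))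
  where
  eq : ∀ i j → (i ℤ.* ℤ.+ 1 ℤ.+ j ℤ.* ℤ.+ 1) ℤ.* ℤ.+ 1 ≡ (i ℤ.+ j) ℤ.* ℤ.+ 1
  eq = ℤ-solve-∀

fromℕ-+ : ∀ a b → fromℕ (a ℕ.+ b) ≡ fromℕ a + fromℕ b
fromℕ-+ a b = sym (/1-homo-+ (ℤ.+ a) (ℤ.+ b))

fromℕ-* : ∀ a b → fromℕ (a ℕ.* b) ≡ fromℕ a * fromℕ b
fromℕ-* a b = trans (cong (_/ 1) (ℤ.pos-* a b)) (sym (/1-homo-* (ℤ.+ a) (ℤ.+ b)))

-- Meant for a composition extended by a last part: `p` and `q` are the values of `Z` before and
-- after, `N` is the new last factor, and the factor `-1ℤ` comes from the additional part.
/⁺-cancel : ∀ i (p q : ℕ⁺) N → val q ≡ val p ℕ.* N →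
            fromℕ N * ((-1ℤ ℤ.* i) /⁺ q) ≡ - (i /⁺ p)
/⁺-cancel i (pos (suc p)) (pos (suc q)) N eq = toℚᵘ-injective
  (ℚᵘ.≃-trans (toℚᵘ-homo-* (fromℕ N) ((-1ℤ ℤ.* i) / suc q))
  (ℚᵘ.≃-trans (ℚᵘ.*-cong (toℚᵘ-/ (ℤ.+ N) 0) (toℚᵘ-/ (-1ℤ ℤ.* i) q))
  (ℚᵘ.≃-trans (*≡* cross)
  (ℚᵘ.≃-trans (ℚᵘ.-‿cong (ℚᵘ.≃-sym (toℚᵘ-/ i p)))
              (ℚᵘ.≃-sym (ℚ.toℚᵘ-homo‿- (i / suc p)))))))
  where
  lem : ∀ n i p → (n ℤ.* (-1ℤ ℤ.* i)) ℤ.* p ≡ ℤ.- i ℤ.* (p ℤ.* n)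
  lem = ℤ-solve-∀
  cross : (ℤ.+ N ℤ.* (-1ℤ ℤ.* i)) ℤ.* ℤ.+ suc p ≡ ℤ.- i ℤ.* ℤ.+ (1 ℕ.* suc q)
  cross = trans (lem (ℤ.+ N) i (ℤ.+ suc p))
    (cong (ℤ.- i ℤ.*_) (trans (sym (ℤ.pos-* (suc p) N))
      (cong ℤ.+_ (trans (sym eq) (sym (ℕ.*-identityˡ (suc q)))))))

-- Indicators and finite sums

ind : Bool → ℚ
ind b = if b then 1ℚ else 0ℚ

-- Conditions enter sums as factors 0 or 1, so that conjunction becomes multiplication and ring laws
-- replace case distinctions.
ind-∧ : ∀ b c → ind (b ∧ c) ≡ ind b * ind c
ind-∧ true  c = sym (ℚ.*-identityˡ (ind c))
ind-∧ false c = sym (ℚ.*-zeroˡ (ind c))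

Σᴸ : List A → (A → ℚ) → ℚ
Σᴸ xs f = sumℚ (map f xs)

Σᴸ-cong : ∀ (xs : List A) {f g} → (∀ x → f x ≡ g x) → Σᴸ xs f ≡ Σᴸ xs g
Σᴸ-cong xs eq = cong sumℚ (map-cong eq xs)

Σᴸ-cong-∈ : ∀ (xs : List A) {f g} → (∀ {x} → x ∈ xs → f x ≡ g x) → Σᴸ xs f ≡ Σᴸ xs g
Σᴸ-cong-∈ []       eq = refl
Σᴸ-cong-∈ (x ∷ xs) eq = cong₂ _+_ (eq (here refl)) (Σᴸ-cong-∈ xs (eq ∘ there))

Σᴸ-0 : ∀ (xs : List A) → Σᴸ xs (λ _ → 0ℚ) ≡ 0ℚ
Σᴸ-0 []       = refl
Σᴸ-0 (x ∷ xs) = trans (ℚ.+-identityˡ _) (Σᴸ-0 xs)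

Σᴸ-zero : ∀ (xs : List A) {f} → (∀ x → f x ≡ 0ℚ) → Σᴸ xs f ≡ 0ℚ
Σᴸ-zero xs f0 = trans (Σᴸ-cong xs f0) (Σᴸ-0 xs)

Σᴸ-+ : ∀ (xs : List A) f g → Σᴸ xs (λ x → f x + g x) ≡ Σᴸ xs f + Σᴸ xs g
Σᴸ-+ []       f g = refl
Σᴸ-+ (x ∷ xs) f g = trans (cong (f x + g x +_) (Σᴸ-+ xs f g))
  (+-interchange (f x) (g x) (Σᴸ xs f) (Σᴸ xs g))

Σᴸ-*ˡ : ∀ c (xs : List A) f → Σᴸ xs (λ x → c * f x) ≡ c * Σᴸ xs f
Σᴸ-*ˡ c []       f = sym (ℚ.*-zeroʳ c)
Σᴸ-*ˡ c (x ∷ xs) f =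
  trans (cong (c * f x +_) (Σᴸ-*ˡ c xs f)) (sym (ℚ.*-distribˡ-+ c (f x) (Σᴸ xs f)))

Σᴸ-*ʳ : ∀ c (xs : List A) f → Σᴸ xs (λ x → f x * c) ≡ Σᴸ xs f * c
Σᴸ-*ʳ c xs f = trans (Σᴸ-cong xs λ x → ℚ.*-comm (f x) c)
  (trans (Σᴸ-*ˡ c xs f) (ℚ.*-comm c (Σᴸ xs f)))

Σᴸ-swap : ∀ (xs : List A) (ys : List B) (f : A → B → ℚ) →
          Σᴸ xs (λ x → Σᴸ ys (f x)) ≡ Σᴸ ys (λ y → Σᴸ xs (λ x → f x y))
Σᴸ-swap []       ys f = sym (Σᴸ-0 ys)
Σᴸ-swap (x ∷ xs) ys f = trans (cong (Σᴸ ys (f x) +_) (Σᴸ-swap xs ys f))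
  (sym (Σᴸ-+ ys (f x) (λ y → Σᴸ xs (λ x → f x y))))

Σᴸ-++ : ∀ (xs ys : List A) f → Σᴸ (xs ++ ys) f ≡ Σᴸ xs f + Σᴸ ys f
Σᴸ-++ []       ys f = sym (ℚ.+-identityˡ _)
Σᴸ-++ (x ∷ xs) ys f =
  trans (cong (f x +_) (Σᴸ-++ xs ys f)) (sym (ℚ.+-assoc (f x) (Σᴸ xs f) (Σᴸ ys f)))

Σᴸ-map : ∀ (g : A → B) xs (f : B → ℚ) → Σᴸ (map g xs) f ≡ Σᴸ xs (f ∘ g)
Σᴸ-map g xs f = cong sumℚ (sym (map-∘ xs))

Σᴸ-filter : ∀ {P : A → Set} (P? : ∀ x → Dec (P x)) xs f →
            Σᴸ (filter P? xs) f ≡ Σᴸ xs (λ x → ind (does (P? x)) * f x)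
Σᴸ-filter P? []       f = refl
Σᴸ-filter P? (x ∷ xs) f with does (P? x)
... | true  = cong₂ _+_ (sym (ℚ.*-identityˡ (f x))) (Σᴸ-filter P? xs f)
... | false = trans (Σᴸ-filter P? xs f)
  (sym (trans (cong (_+ Σᴸ xs (λ x → ind (does (P? x)) * f x)) (ℚ.*-zeroˡ (f x)))
    (ℚ.+-identityˡ _)))

Σᴸ-cartesianProductWith : ∀ (g : A → B → C) xs ys f →
  Σᴸ (cartesianProductWith g xs ys) f ≡ Σᴸ xs (λ x → Σᴸ ys (λ y → f (g x y)))
Σᴸ-cartesianProductWith g []       ys f = refl
Σᴸ-cartesianProductWith g (x ∷ xs) ys f =
  trans (Σᴸ-++ (map (g x) ys) (cartesianProductWith g xs ys) f)
    (cong₂ _+_ (Σᴸ-map (g x) ys f) (Σᴸ-cartesianProductWith g xs ys f))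

Σᴸ-upTo-suc : ∀ n (f : ℕ → ℚ) → Σᴸ (upTo (suc n)) f ≡ f 0 + Σᴸ (upTo n) (f ∘ suc)
Σᴸ-upTo-suc n f = cong (λ xs → f 0 + sumℚ xs)
  (trans (map-applyUpTo suc f n) (sym (map-upTo (f ∘ suc) n)))

-- Graded coalgebras and their lifting to lists

Splitter : Set → Set
Splitter A = A → List (A × A)

-- Sweedler notation for the coproduct `s`. By definition `(f ⊛ g) m` is `∫ splits m` applied to
-- `f a * g b`.
∫ : Splitter A → A → (A → A → ℚ) → ℚ
∫ s x F = Σᴸ (s x) (λ (a , b) → F a b)

module _ (s : Splitter A) (x : A) where

  ∫-cong : ∀ {F G : A → A → ℚ} → (∀ a b → F a b ≡ G a b) → ∫ s x F ≡ ∫ s x G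
  ∫-cong eq = Σᴸ-cong (s x) λ (a , b) → eq a b

  ∫-+ : ∀ F G → ∫ s x (λ a b → F a b + G a b) ≡ ∫ s x F + ∫ s x G
  ∫-+ F G = Σᴸ-+ (s x) _ _

  ∫-*ˡ : ∀ c F → ∫ s x (λ a b → c * F a b) ≡ c * ∫ s x F
  ∫-*ˡ c F = Σᴸ-*ˡ c (s x) _

  ∫-*ʳ : ∀ c F → ∫ s x (λ a b → F a b * c) ≡ ∫ s x F * c
  ∫-*ʳ c F = Σᴸ-*ʳ c (s x) _

∫-swap : ∀ (s : Splitter A) x (t : Splitter B) y (F : A → A → B → B → ℚ) →
         ∫ s x (λ a b → ∫ t y (λ c d → F a b c d)) ≡
         ∫ t y (λ c d → ∫ s x (λ a b → F a b c d))
∫-swap s x t y F = Σᴸ-swap (s x) (t y) λ (a , b) (c , d) → F a b c d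

∫ᴸ-∷ : ∀ (s : Splitter A) x xs F →
       ∫ (splitsᴸ s) (x ∷ xs) F ≡
       ∫ s x (λ a b → ∫ (splitsᴸ s) xs (λ as bs → F (a ∷ as) (b ∷ bs)))
∫ᴸ-∷ s x xs F = Σᴸ-cartesianProductWith _ (s x) (splitsᴸ s xs) _

-- z is the counit and n a grading compatible with the splitting s.
record IsCoalgebra (s : Splitter A) (z : A → ℚ) (n : A → ℕ) : Set where
  field
    coassoc   : ∀ x (F : A → A → A → ℚ) →
                ∫ s x (λ a b → ∫ s a (λ c d → F c d b)) ≡
                ∫ s x (λ a b → ∫ s b (λ c d → F a c d))
    counitˡ   : ∀ x (f : A → ℚ) → ∫ s x (λ a b → z a * f b) ≡ f x
    counitʳ   : ∀ x (f : A → ℚ) → ∫ s x (λ a b → f a * z b) ≡ f x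
    graded    : ∀ x (F : ℕ → A → A → ℚ) →
                ∫ s x (λ a b → F (n a ℕ.+ n b) a b) ≡ ∫ s x (λ a b → F (n x) a b)
    z-degree0 : ∀ x (F : ℕ → ℚ) → z x * F (n x) ≡ z x * F 0

Prod : (A → ℚ) → List A → ℚ
Prod f []       = 1ℚ
Prod f (x ∷ xs) = f x * Prod f xs

-- One formula for both gradings: all exponents within a row have weight 1, while row `i` of a
-- monomial has weight `i`.
wt : (ℕ → ℕ) → (A → ℕ) → ℕ → List A → ℕ
wt c n i []       = 0
wt c n i (x ∷ xs) = c i ℕ.* n x ℕ.+ wt c n (suc i) xs

-- The sum over all positions k of c (i + k) times w at position k and z elsewhere.
der : (ℕ → ℕ) → (A → ℚ) → (A → ℚ) → ℕ → List A → ℚ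
der c z w i []       = 0ℚ
der c z w i (x ∷ xs) = fromℕ (c i) * (w x * Prod z xs) + z x * der c z w (suc i) xs

∫-* : ∀ (s : Splitter A) x (t : Splitter B) y
      (f g : A → ℚ) (h k : B → ℚ) →
      ∫ s x (λ a b → ∫ t y (λ c d → (f a * h c) * (g b * k d))) ≡
      ∫ s x (λ a b → f a * g b) * ∫ t y (λ c d → h c * k d)
∫-* s x t y f g h k = begin
  ∫ s x (λ a b → ∫ t y (λ c d → (f a * h c) * (g b * k d)))
    ≡⟨ ∫-cong s x (λ a b → trans (∫-cong t y (λ c d → *-interchange (f a) (h c) (g b) (k d)))
                                 (∫-*ˡ t y (f a * g b) (λ c d → h c * k d))) ⟩
  ∫ s x (λ a b → (f a * g b) * ∫ t y (λ c d → h c * k d))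
    ≡⟨ ∫-*ʳ s x _ (λ a b → f a * g b) ⟩
  ∫ s x (λ a b → f a * g b) * ∫ t y (λ c d → h c * k d) ∎

module _ {s : Splitter A} {z : A → ℚ} {n : A → ℕ} (co : IsCoalgebra s z n) where
  open IsCoalgebra co

  private
    sᴸ : Splitter (List A)
    sᴸ = splitsᴸ s

  -- Lists are split entry by entry. Once the inner split of the head is moved past the split of the
  -- tail, head and tail separate: `coassoc` handles the one, induction the other.
  coassocᴸ : ∀ xs (F : List A → List A → List A → ℚ) →
             ∫ sᴸ xs (λ as bs → ∫ sᴸ as (λ cs ds → F cs ds bs)) ≡
             ∫ sᴸ xs (λ as bs → ∫ sᴸ bs (λ cs ds → F as cs ds))
  coassocᴸ []       F = refl
  coassocᴸ (x ∷ xs) F = begin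
    ∫ sᴸ (x ∷ xs) (λ as bs → ∫ sᴸ as (λ cs ds → F cs ds bs))
      ≡⟨ ∫ᴸ-∷ s x xs _ ⟩
    ∫ s x (λ a b → ∫ sᴸ xs (λ as bs → ∫ sᴸ (a ∷ as) (λ cs ds → F cs ds (b ∷ bs))))
      ≡⟨ ∫-cong s x (λ a b → trans
           (∫-cong sᴸ xs λ as bs → ∫ᴸ-∷ s a as _)
           (∫-swap sᴸ xs s a λ as bs c d →
             ∫ sᴸ as (λ cs ds → F (c ∷ cs) (d ∷ ds) (b ∷ bs)))) ⟩
    ∫ s x (λ a b → ∫ s a (λ c d → ∫ sᴸ xs (λ as bs → ∫ sᴸ as (λ cs ds →
      F (c ∷ cs) (d ∷ ds) (b ∷ bs)))))
      ≡⟨ coassoc x (λ c d b → ∫ sᴸ xs (λ as bs → ∫ sᴸ as (λ cs ds →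
           F (c ∷ cs) (d ∷ ds) (b ∷ bs)))) ⟩
    ∫ s x (λ a b → ∫ s b (λ c d → ∫ sᴸ xs (λ as bs → ∫ sᴸ as (λ cs ds →
      F (a ∷ cs) (c ∷ ds) (d ∷ bs)))))
      ≡⟨ ∫-cong s x (λ a b → trans
           (∫-cong s b λ c d → coassocᴸ xs (λ cs ds bs → F (a ∷ cs) (c ∷ ds) (d ∷ bs)))
           (trans (∫-swap s b sᴸ xs λ c d as bs →
             ∫ sᴸ bs (λ cs ds → F (a ∷ as) (c ∷ cs) (d ∷ ds)))
             (∫-cong sᴸ xs λ as bs → sym (∫ᴸ-∷ s b bs _)))) ⟩
    ∫ s x (λ a b → ∫ sᴸ xs (λ as bs → ∫ sᴸ (b ∷ bs) (λ cs ds → F (a ∷ as) cs ds)))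
      ≡⟨ ∫ᴸ-∷ s x xs _ ⟨
    ∫ sᴸ (x ∷ xs) (λ as bs → ∫ sᴸ bs (λ cs ds → F as cs ds)) ∎

  counitˡᴸ : ∀ xs (f : List A → ℚ) → ∫ sᴸ xs (λ as bs → Prod z as * f bs) ≡ f xs
  counitˡᴸ []       f = trans (ℚ.+-identityʳ _) (ℚ.*-identityˡ (f []))
  counitˡᴸ (x ∷ xs) f = begin
    ∫ sᴸ (x ∷ xs) (λ as bs → Prod z as * f bs)
      ≡⟨ ∫ᴸ-∷ s x xs _ ⟩
    ∫ s x (λ a b → ∫ sᴸ xs (λ as bs → z a * Prod z as * f (b ∷ bs)))
      ≡⟨ ∫-cong s x (λ a b → trans
           (trans (∫-cong sᴸ xs λ as bs → ℚ.*-assoc (z a) (Prod z as) _) (∫-*ˡ sᴸ xs (z a) _))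
           (cong (z a *_) (counitˡᴸ xs (λ bs → f (b ∷ bs))))) ⟩
    ∫ s x (λ a b → z a * f (b ∷ xs))
      ≡⟨ counitˡ x (λ b → f (b ∷ xs)) ⟩
    f (x ∷ xs) ∎

  counitʳᴸ : ∀ xs (f : List A → ℚ) → ∫ sᴸ xs (λ as bs → f as * Prod z bs) ≡ f xs
  counitʳᴸ []       f = trans (ℚ.+-identityʳ _) (ℚ.*-identityʳ (f []))
  counitʳᴸ (x ∷ xs) f = begin
    ∫ sᴸ (x ∷ xs) (λ as bs → f as * Prod z bs)
      ≡⟨ ∫ᴸ-∷ s x xs _ ⟩
    ∫ s x (λ a b → ∫ sᴸ xs (λ as bs → f (a ∷ as) * (z b * Prod z bs)))
      ≡⟨ ∫-cong s x (λ a b → trans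
           (trans (∫-cong sᴸ xs λ as bs → rearrange (f (a ∷ as)) (z b) (Prod z bs))
             (∫-*ʳ sᴸ xs (z b) _))
           (cong (_* z b) (counitʳᴸ xs (λ as → f (a ∷ as))))) ⟩
    ∫ s x (λ a b → f (a ∷ xs) * z b)
      ≡⟨ counitʳ x (λ a → f (a ∷ xs)) ⟩
    f (x ∷ xs) ∎
    where
    rearrange : ∀ a b c → a * (b * c) ≡ (a * c) * b
    rearrange = solve-∀ ℚ-ring

  -- The degree is replaced inside an arbitrary summand `F`. So induction can be applied with an `F`
  -- that already adds the share of the head, and `graded` with one that adds the share of the tail.
  gradedᴸ : ∀ c i xs (F : ℕ → List A → List A → ℚ) →
            ∫ sᴸ xs (λ as bs → F (wt c n i as ℕ.+ wt c n i bs) as bs) ≡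
            ∫ sᴸ xs (λ as bs → F (wt c n i xs) as bs)
  gradedᴸ c i []       F = refl
  gradedᴸ c i (x ∷ xs) F = begin
    ∫ sᴸ (x ∷ xs) (λ as bs → F (wt c n i as ℕ.+ wt c n i bs) as bs)
      ≡⟨ ∫ᴸ-∷ s x xs _ ⟩
    ∫ s x (λ a b → ∫ sᴸ xs (λ as bs →
      F ((c i ℕ.* n a ℕ.+ w as) ℕ.+ (c i ℕ.* n b ℕ.+ w bs)) (a ∷ as) (b ∷ bs)))
      ≡⟨ ∫-cong s x (λ a b → trans
           (∫-cong sᴸ xs λ as bs → cong (λ d → F d (a ∷ as) (b ∷ bs))
             (rearrange (c i) (n a) (w as) (n b) (w bs)))
           (gradedᴸ c (suc i) xs (λ d as bs → F (c i ℕ.* (n a ℕ.+ n b) ℕ.+ d) (a ∷ as) (b ∷ bs)))) ⟩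
    ∫ s x (λ a b → ∫ sᴸ xs (λ as bs → F (c i ℕ.* (n a ℕ.+ n b) ℕ.+ w xs) (a ∷ as) (b ∷ bs)))
      ≡⟨ graded x (λ d a b → ∫ sᴸ xs (λ as bs → F (c i ℕ.* d ℕ.+ w xs) (a ∷ as) (b ∷ bs))) ⟩
    ∫ s x (λ a b → ∫ sᴸ xs (λ as bs → F (c i ℕ.* n x ℕ.+ w xs) (a ∷ as) (b ∷ bs)))
      ≡⟨ ∫ᴸ-∷ s x xs _ ⟨
    ∫ sᴸ (x ∷ xs) (λ as bs → F (wt c n i (x ∷ xs)) as bs) ∎
    where
    w = wt c n (suc i)
    rearrange : ∀ c a p b q →
                (c ℕ.* a ℕ.+ p) ℕ.+ (c ℕ.* b ℕ.+ q) ≡ c ℕ.* (a ℕ.+ b) ℕ.+ (p ℕ.+ q)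
    rearrange = ℕ-solve-∀

  z-degree0ᴸ : ∀ c i xs (F : ℕ → ℚ) → Prod z xs * F (wt c n i xs) ≡ Prod z xs * F 0
  z-degree0ᴸ c i []       F = refl
  z-degree0ᴸ c i (x ∷ xs) F = begin
    z x * p * F (c i ℕ.* n x ℕ.+ wt c n (suc i) xs)
      ≡⟨ swap (z x) p _ ⟩
    p * (z x * F (c i ℕ.* n x ℕ.+ wt c n (suc i) xs))
      ≡⟨ cong (p *_) (z-degree0 x (λ d → F (c i ℕ.* d ℕ.+ wt c n (suc i) xs))) ⟩
    p * (z x * F (c i ℕ.* 0 ℕ.+ wt c n (suc i) xs))
      ≡⟨ swap (z x) p _ ⟨
    z x * p * F (c i ℕ.* 0 ℕ.+ wt c n (suc i) xs)
      ≡⟨ ℚ.*-assoc (z x) p _ ⟩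
    z x * (p * F (c i ℕ.* 0 ℕ.+ wt c n (suc i) xs))
      ≡⟨ cong (z x *_) (z-degree0ᴸ c (suc i) xs (λ d → F (c i ℕ.* 0 ℕ.+ d))) ⟩
    z x * (p * F (c i ℕ.* 0 ℕ.+ 0))
      ≡⟨ ℚ.*-assoc (z x) p _ ⟨
    z x * p * F (c i ℕ.* 0 ℕ.+ 0)
      ≡⟨ cong (λ d → z x * p * F d) (trans (ℕ.+-identityʳ (c i ℕ.* 0)) (ℕ.*-zeroʳ (c i))) ⟩
    z x * p * F 0 ∎
    where
    p = Prod z xs
    swap : ∀ a b c → a * b * c ≡ b * (a * c)
    swap = solve-∀ ℚ-ring

  isCoalgebraᴸ : ∀ c i → IsCoalgebra sᴸ (Prod z) (wt c n i)
  isCoalgebraᴸ c i = record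
    { coassoc   = coassocᴸ
    ; counitˡ   = counitˡᴸ
    ; counitʳ   = counitʳᴸ
    ; graded    = gradedᴸ c i
    ; z-degree0 = z-degree0ᴸ c i
    }

  -- w acts on e as a logarithmic derivative does, and so does der on Prod e.
  logDerivᴸ : ∀ {e w : A → ℚ} →
              (∀ x → ∫ s x (λ a b → e a * w b) ≡ - (fromℕ (n x) * e x)) →
              ∀ c i xs → ∫ sᴸ xs (λ as bs → Prod e as * der c z w i bs) ≡
                         - (fromℕ (wt c n i xs) * Prod e xs)
  logDerivᴸ {e} {w} logDeriv c i []       =
    refl
  logDerivᴸ {e} {w} logDeriv c i (x ∷ xs) = begin
    ∫ sᴸ (x ∷ xs) (λ as bs → Prod e as * der c z w i bs)
      ≡⟨ ∫ᴸ-∷ s x xs _ ⟩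
    ∫ s x (λ a b → ∫ sᴸ xs (λ as bs →
      e a * Prod e as * (k * (w b * Prod z bs) + z b * der c z w (suc i) bs)))
      ≡⟨ ∫-cong s x (λ a b → trans
           (∫-cong sᴸ xs λ as bs →
             rearrange (e a) (Prod e as) k (w b) (Prod z bs) (z b) (der c z w (suc i) bs))
           (trans (∫-+ sᴸ xs _ _) (cong (_+ ∫ sᴸ xs _) (∫-*ˡ sᴸ xs k _)))) ⟩
    ∫ s x (λ a b →
      k * ∫ sᴸ xs (λ as bs → e a * Prod e as * (w b * Prod z bs)) +
      ∫ sᴸ xs (λ as bs → e a * Prod e as * (z b * der c z w (suc i) bs)))
      ≡⟨ trans (∫-+ s x _ _) (cong (_+ ∫ s x _) (∫-*ˡ s x k _)) ⟩
    k * ∫ s x (λ a b → ∫ sᴸ xs (λ as bs → e a * Prod e as * (w b * Prod z bs))) +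
    ∫ s x (λ a b → ∫ sᴸ xs (λ as bs → e a * Prod e as * (z b * der c z w (suc i) bs)))
      ≡⟨ cong₂ (λ p q → k * p + q)
           (∫-* s x sᴸ xs e w (Prod e) (Prod z))
           (∫-* s x sᴸ xs e z (Prod e) (der c z w (suc i))) ⟩
    k * (∫ s x (λ a b → e a * w b) * ∫ sᴸ xs (λ as bs → Prod e as * Prod z bs)) +
    ∫ s x (λ a b → e a * z b) * ∫ sᴸ xs (λ as bs → Prod e as * der c z w (suc i) bs)
      -- Leibniz rule: where `w` acts on the head, the tail meets only the counit, and where it acts
      -- in the tail, the head does. Convolution with the counit gives back `Prod e xs` and `e x`.
      ≡⟨ cong₂ _+_
           (cong (k *_) (cong₂ _*_ (logDeriv x) (counitʳᴸ xs (Prod e))))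
           (cong₂ _*_ (counitʳ x e) (logDerivᴸ logDeriv c (suc i) xs)) ⟩
    k * (- (fromℕ (n x) * e x) * Prod e xs) +
    e x * (- (fromℕ (wt c n (suc i) xs) * Prod e xs))
      ≡⟨ collect k (fromℕ (n x)) (e x) (Prod e xs) (fromℕ (wt c n (suc i) xs)) ⟩
    - ((k * fromℕ (n x) + fromℕ (wt c n (suc i) xs)) * (e x * Prod e xs))
      ≡⟨ cong (λ d → - (d * (e x * Prod e xs)))
           (trans (cong (_+ _) (sym (fromℕ-* (c i) (n x)))) (sym (fromℕ-+ (c i ℕ.* n x) _))) ⟩
    - (fromℕ (wt c n i (x ∷ xs)) * Prod e (x ∷ xs)) ∎
    where
    k = fromℕ (c i)
    rearrange : ∀ a b k c d f g →
                a * b * (k * (c * d) + f * g) ≡ k * (a * b * (c * d)) + a * b * (f * g)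
    rearrange = solve-∀ ℚ-ring
    collect : ∀ k m a b q →
              k * (- (m * a) * b) + a * (- (q * b)) ≡ - ((k * m + q) * (a * b))
    collect = solve-∀ ℚ-ring

-- Each term of `der` has a factor `w` at some position `k` not before `i`. As `w` vanishes in
-- degree 0, a nonzero term forces weight at least `c k`, hence at least `c i`.
der-low : ∀ {n : A → ℕ} {z w : A → ℚ} → (∀ x → n x ≡ 0 → w x ≡ 0ℚ) →
          ∀ {c} → (∀ i → c i ≤ c (suc i)) →
          ∀ i xs → wt c n i xs < c i → der c z w i xs ≡ 0ℚ
der-low w0 mono i [] lt = refl
der-low {n = n} {z} {w} w0 {c} mono i (x ∷ xs) lt with n x in eq
... | suc k = ⊥-elim (ℕ.<⇒≱ lt (ℕ.≤-trans (ℕ.m≤m*n (c i) (suc k)) (ℕ.m≤m+n _ _)))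
... | zero  = begin
  fromℕ (c i) * (w x * Prod z xs) + z x * der c z w (suc i) xs
    ≡⟨ cong₂ (λ p q → fromℕ (c i) * (p * Prod z xs) + z x * q) (w0 x eq)
         (der-low w0 mono (suc i) xs (ℕ.<-≤-trans
           (subst (λ d → d ℕ.+ wt c n (suc i) xs < c i) (ℕ.*-zeroʳ (c i)) lt) (mono i))) ⟩
  fromℕ (c i) * (0ℚ * Prod z xs) + z x * 0ℚ
    ≡⟨ vanish (fromℕ (c i)) (Prod z xs) (z x) ⟩
  0ℚ ∎
  where
  vanish : ∀ k a b → k * (0ℚ * a) + b * 0ℚ ≡ 0ℚ
  vanish = solve-∀ ℚ-ring

-- The coalgebra of exponents of one indeterminate

∫ℕ-suc : ∀ n F → ∫ splitsℕ (suc n) F ≡ F 0 (suc n) + ∫ splitsℕ n (λ a b → F (suc a) b)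
∫ℕ-suc n F = begin
  ∫ splitsℕ (suc n) F
    ≡⟨ Σᴸ-map (λ a → a , suc n ∸ a) (upTo (suc (suc n))) (λ (a , b) → F a b) ⟩
  Σᴸ (upTo (suc (suc n))) (λ a → F a (suc n ∸ a))
    ≡⟨ Σᴸ-upTo-suc (suc n) (λ a → F a (suc n ∸ a)) ⟩
  F 0 (suc n) + Σᴸ (upTo (suc n)) (λ a → F (suc a) (n ∸ a))
    ≡⟨ cong (F 0 (suc n) +_)
         (Σᴸ-map (λ a → a , n ∸ a) (upTo (suc n)) (λ (a , b) → F (suc a) b)) ⟨
  F 0 (suc n) + ∫ splitsℕ n (λ a b → F (suc a) b) ∎

ε₀ w₀ z₀ : ℕ → ℚ

-- The coefficients of 1 − x.
ε₀ 0             = 1ℚ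
ε₀ 1             = - 1ℚ
ε₀ (suc (suc _)) = 0ℚ

-- The coefficients of x + x² + ⋯ = x / (1 − x).
w₀ zero    = 0ℚ
w₀ (suc _) = 1ℚ

z₀ zero    = 1ℚ
z₀ (suc _) = 0ℚ

∫ℕ-0 : ∀ n (F : ℕ → ℕ → ℚ) → (∀ a b → F a b ≡ 0ℚ) → ∫ splitsℕ n F ≡ 0ℚ
∫ℕ-0 n F F0 = Σᴸ-zero (splitsℕ n) λ (a , b) → F0 a b

ℕ-isCoalgebra : IsCoalgebra splitsℕ z₀ id
ℕ-isCoalgebra = record
  { coassoc   = coassoc
  ; counitˡ   = counitˡ
  ; counitʳ   = counitʳ
  ; graded    = graded
  ; z-degree0 = λ where
      zero    F → refl
      (suc n) F → trans (ℚ.*-zeroˡ (F (suc n))) (sym (ℚ.*-zeroˡ (F 0)))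
  }
  where
  coassoc : ∀ n (F : ℕ → ℕ → ℕ → ℚ) →
            ∫ splitsℕ n (λ a b → ∫ splitsℕ a (λ c d → F c d b)) ≡
            ∫ splitsℕ n (λ a b → ∫ splitsℕ b (λ c d → F a c d))
  coassoc zero    F = refl
  coassoc (suc n) F = begin
    ∫ splitsℕ (suc n) (λ a b → ∫ splitsℕ a (λ c d → F c d b))
      ≡⟨ ∫ℕ-suc n (λ a b → ∫ splitsℕ a (λ c d → F c d b)) ⟩
    (F 0 0 (suc n) + 0ℚ) + ∫ splitsℕ n (λ a b → ∫ splitsℕ (suc a) (λ c d → F c d b))
      ≡⟨ cong₂ _+_ (ℚ.+-identityʳ (F 0 0 (suc n)))
           (∫-cong splitsℕ n λ a b → ∫ℕ-suc a (λ c d → F c d b)) ⟩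
    F 0 0 (suc n) + ∫ splitsℕ n (λ a b →
      F 0 (suc a) b + ∫ splitsℕ a (λ c d → F (suc c) d b))
      ≡⟨ cong (F 0 0 (suc n) +_) (∫-+ splitsℕ n (λ a b → F 0 (suc a) b)
           (λ a b → ∫ splitsℕ a (λ c d → F (suc c) d b))) ⟩
    F 0 0 (suc n) + (∫ splitsℕ n (λ a b → F 0 (suc a) b) +
                     ∫ splitsℕ n (λ a b → ∫ splitsℕ a (λ c d → F (suc c) d b)))
      ≡⟨ ℚ.+-assoc (F 0 0 (suc n)) _ _ ⟨
    (F 0 0 (suc n) + ∫ splitsℕ n (λ a b → F 0 (suc a) b)) +
    ∫ splitsℕ n (λ a b → ∫ splitsℕ a (λ c d → F (suc c) d b))
      ≡⟨ cong₂ _+_ (sym (∫ℕ-suc n (F 0))) (coassoc n (λ c d b → F (suc c) d b)) ⟩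
    ∫ splitsℕ (suc n) (F 0) + ∫ splitsℕ n (λ a b → ∫ splitsℕ b (λ c d → F (suc a) c d))
      ≡⟨ ∫ℕ-suc n (λ a b → ∫ splitsℕ b (λ c d → F a c d)) ⟨
    ∫ splitsℕ (suc n) (λ a b → ∫ splitsℕ b (λ c d → F a c d)) ∎

  counitˡ : ∀ n (f : ℕ → ℚ) → ∫ splitsℕ n (λ a b → z₀ a * f b) ≡ f n
  counitˡ zero    f = trans (ℚ.+-identityʳ _) (ℚ.*-identityˡ (f 0))
  counitˡ (suc n) f = begin
    ∫ splitsℕ (suc n) (λ a b → z₀ a * f b)
      ≡⟨ ∫ℕ-suc n (λ a b → z₀ a * f b) ⟩
    1ℚ * f (suc n) + ∫ splitsℕ n (λ a b → 0ℚ * f b)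
      ≡⟨ cong₂ _+_ (ℚ.*-identityˡ (f (suc n)))
           (∫ℕ-0 n (λ a b → 0ℚ * f b) λ a b → ℚ.*-zeroˡ (f b)) ⟩
    f (suc n) + 0ℚ
      ≡⟨ ℚ.+-identityʳ (f (suc n)) ⟩
    f (suc n) ∎

  counitʳ : ∀ n (f : ℕ → ℚ) → ∫ splitsℕ n (λ a b → f a * z₀ b) ≡ f n
  counitʳ zero    f = trans (ℚ.+-identityʳ _) (ℚ.*-identityʳ (f 0))
  counitʳ (suc n) f = begin
    ∫ splitsℕ (suc n) (λ a b → f a * z₀ b)
      ≡⟨ ∫ℕ-suc n (λ a b → f a * z₀ b) ⟩
    f 0 * 0ℚ + ∫ splitsℕ n (λ a b → f (suc a) * z₀ b)
      ≡⟨ cong₂ _+_ (ℚ.*-zeroʳ (f 0)) (counitʳ n (f ∘ suc)) ⟩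
    0ℚ + f (suc n)
      ≡⟨ ℚ.+-identityˡ (f (suc n)) ⟩
    f (suc n) ∎

  graded : ∀ n (F : ℕ → ℕ → ℕ → ℚ) →
           ∫ splitsℕ n (λ a b → F (a ℕ.+ b) a b) ≡ ∫ splitsℕ n (λ a b → F n a b)
  graded zero    F = refl
  graded (suc n) F = begin
    ∫ splitsℕ (suc n) (λ a b → F (a ℕ.+ b) a b)
      ≡⟨ ∫ℕ-suc n (λ a b → F (a ℕ.+ b) a b) ⟩
    F (suc n) 0 (suc n) + ∫ splitsℕ n (λ a b → F (suc (a ℕ.+ b)) (suc a) b)
      ≡⟨ cong (F (suc n) 0 (suc n) +_) (graded n (λ d a b → F (suc d) (suc a) b)) ⟩
    F (suc n) 0 (suc n) + ∫ splitsℕ n (λ a b → F (suc n) (suc a) b)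
      ≡⟨ ∫ℕ-suc n (F (suc n)) ⟨
    ∫ splitsℕ (suc n) (F (suc n)) ∎

-- (1 − x) · x / (1 − x) = − x · d/dx (1 − x).
logDeriv₀ : ∀ n → ∫ splitsℕ n (λ a b → ε₀ a * w₀ b) ≡ - (fromℕ n * ε₀ n)
logDeriv₀ 0             = refl
logDeriv₀ 1             = refl
logDeriv₀ (suc (suc n)) = begin
  ∫ splitsℕ (suc (suc n)) (λ a b → ε₀ a * w₀ b)
    ≡⟨ ∫ℕ-suc (suc n) (λ a b → ε₀ a * w₀ b) ⟩
  1ℚ + ∫ splitsℕ (suc n) (λ a b → ε₀ (suc a) * w₀ b)
    ≡⟨ cong (1ℚ +_) (∫ℕ-suc n (λ a b → ε₀ (suc a) * w₀ b)) ⟩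
  1ℚ + (- 1ℚ + ∫ splitsℕ n (λ a b → 0ℚ * w₀ b))
    -- Only `a = 0` and `a = 1` meet a nonzero `ε₀`. The exponent is at least 2, so `b` is positive
    -- in both cases, and the contributions 1 and -1 cancel.
    ≡⟨ cong (λ q → 1ℚ + (- 1ℚ + q)) (∫ℕ-0 n (λ a b → 0ℚ * w₀ b) λ a b → ℚ.*-zeroˡ (w₀ b)) ⟩
  0ℚ
    ≡⟨ cong -_ (ℚ.*-zeroʳ (fromℕ (suc (suc n)))) ⟨
  - (fromℕ (suc (suc n)) * 0ℚ) ∎

-- The series `ε` and `p` on rows and monomials

degʳ : Row → ℕ
degʳ = wt (λ _ → 1) id 0

degᵐ : Monomial → ℕ
degᵐ = wt id degʳ 1

degʳ≡sum : ∀ i r → wt (λ _ → 1) id i r ≡ sum r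
degʳ≡sum i []      = refl
degʳ≡sum i (a ∷ r) = cong₂ ℕ._+_ (ℕ.*-identityˡ a) (degʳ≡sum (suc i) r)

deg-from≡wt : ∀ i m → deg-from i m ≡ wt id degʳ i m
deg-from≡wt i []      = refl
deg-from≡wt i (r ∷ m) =
  cong₂ (λ s t → i ℕ.* s ℕ.+ t) (sym (degʳ≡sum 0 r)) (deg-from≡wt (suc i) m)

-- For the indeterminates of one row, `zʳ` is the series 1 and `uʳ` is the sum of all `x / (1 − x)`,
-- that is, of all positive powers of single indeterminates.
zʳ uʳ : Row → ℚ
zʳ = Prod z₀
uʳ = der (λ _ → 1) z₀ w₀ 0

zᵐ ε p : Monomial → ℚ
zᵐ = Prod zʳ
ε  = Prod (Prod ε₀)

-- i at the monomials x_{i,j}ᵉ with e ≥ 1, and 0 elsewhere; that is, the sum of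
-- all power sums.
p = der id zʳ uʳ 1

row-isCoalgebra : IsCoalgebra (splitsᴸ splitsℕ) zʳ degʳ
row-isCoalgebra = isCoalgebraᴸ ℕ-isCoalgebra (λ _ → 1) 0

monomial-isCoalgebra : IsCoalgebra splits zᵐ degᵐ
monomial-isCoalgebra = isCoalgebraᴸ row-isCoalgebra id 1

logDeriv : ∀ m → ∫ splits m (λ a b → ε a * p b) ≡ - (fromℕ (degᵐ m) * ε m)
logDeriv = logDerivᴸ row-isCoalgebra
  (logDerivᴸ ℕ-isCoalgebra logDeriv₀ (λ _ → 1) 0) id 1

uʳ-low : ∀ r → degʳ r ≡ 0 → uʳ r ≡ 0ℚ
uʳ-low r deg≡0 = der-low (λ where zero _ → refl; (suc _) ()) (λ _ → ℕ.≤-refl) 0 r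
  (s≤s (ℕ.≤-reflexive deg≡0))

p-low : ∀ i m → wt id degʳ i m < i → der id zʳ uʳ i m ≡ 0ℚ
p-low = der-low uʳ-low ℕ.n≤1+n

-- `E d` as the part of degree `d` of `ε`

sgn : ℕ → ℚ
sgn n = (-1ℤ ℤ.^ n) / 1

sgn-+ : ∀ m n → sgn (m ℕ.+ n) ≡ sgn m * sgn n
sgn-+ m n = trans (cong (_/ 1) (ℤ.^-distribˡ-+-* -1ℤ m n))
  (sym (/1-homo-* (-1ℤ ℤ.^ m) (-1ℤ ℤ.^ n)))

Prod-ε₀ : ∀ r → Prod ε₀ r ≡ ind (does (All.all? (ℕ._≤? 1) r)) * sgn (length (filter (1 ℕ.≤?_) r))
Prod-ε₀ []                = refl
Prod-ε₀ (0 ∷ r)           = trans (ℚ.*-identityˡ _) (Prod-ε₀ r)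
Prod-ε₀ (1 ∷ r)           = begin
  - 1ℚ * Prod ε₀ r     ≡⟨ cong (- 1ℚ *_) (Prod-ε₀ r) ⟩
  - 1ℚ * (i * sgn n)   ≡⟨ swap (- 1ℚ) i (sgn n) ⟩
  i * (- 1ℚ * sgn n)   ≡⟨ cong (i *_) (sgn-+ 1 n) ⟨
  i * sgn (suc n)      ∎
  where
  i = ind (does (All.all? (ℕ._≤? 1) r))
  n = length (filter (1 ℕ.≤?_) r)
  swap : ∀ a b c → a * (b * c) ≡ b * (a * c)
  swap = solve-∀ ℚ-ring
Prod-ε₀ (suc (suc a) ∷ r) = trans (ℚ.*-zeroˡ (Prod ε₀ r))
  (sym (ℚ.*-zeroˡ (sgn (length (filter (1 ℕ.≤?_) (suc (suc a) ∷ r))))))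

ε≡sgn : ∀ m → ε m ≡ ind (does (squareFreeᵐ? m)) * sgn (#vars m)
ε≡sgn []      = refl
ε≡sgn (r ∷ m) = begin
  Prod ε₀ r * ε m
    ≡⟨ cong₂ _*_ (Prod-ε₀ r) (ε≡sgn m) ⟩
  (i * sgn k) * (j * sgn (#vars m))
    ≡⟨ *-interchange i (sgn k) j (sgn (#vars m)) ⟩
  (i * j) * (sgn k * sgn (#vars m))
    ≡⟨ cong₂ _*_ (sym (ind-∧ (does (All.all? (ℕ._≤? 1) r)) (does (squareFreeᵐ? m))))
         (trans (sym (sgn-+ k (#vars m))) (cong sgn (sym #vars-∷))) ⟩
  ind (does (squareFreeᵐ? (r ∷ m))) * sgn (#vars (r ∷ m)) ∎
  where
  i = ind (does (All.all? (ℕ._≤? 1) r))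
  j = ind (does (squareFreeᵐ? m))
  k = length (filter (1 ℕ.≤?_) r)
  #vars-∷ : #vars (r ∷ m) ≡ k ℕ.+ #vars m
  #vars-∷ = trans (cong length (filter-++ (1 ℕ.≤?_) r (concat m)))
    (length-++ (filter (1 ℕ.≤?_) r))

E≡ : ∀ d m → E d m ≡ ind (does (degᵐ m ℕ.≟ d)) * ε m
E≡ d m = begin
  E d m
    ≡⟨ if-ind (does (squareFreeᵐ? m ×-dec (deg m ℕ.≟ d))) (sgn (#vars m)) ⟩
  ind (does (squareFreeᵐ? m) ∧ does (deg m ℕ.≟ d)) * sgn (#vars m)
    ≡⟨ cong (_* sgn (#vars m)) (ind-∧ (does (squareFreeᵐ? m)) _) ⟩
  (ind (does (squareFreeᵐ? m)) * ind (does (deg m ℕ.≟ d))) * sgn (#vars m)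
    ≡⟨ rearrange (ind (does (squareFreeᵐ? m))) (ind (does (deg m ℕ.≟ d))) (sgn (#vars m)) ⟩
  ind (does (deg m ℕ.≟ d)) * (ind (does (squareFreeᵐ? m)) * sgn (#vars m))
    ≡⟨ cong₂ (λ k q → ind (does (k ℕ.≟ d)) * q) (deg-from≡wt 1 m) (sym (ε≡sgn m)) ⟩
  ind (does (degᵐ m ℕ.≟ d)) * ε m ∎
  where
  if-ind : ∀ b q → (if b then q else 0ℚ) ≡ ind b * q
  if-ind true  q = sym (ℚ.*-identityˡ q)
  if-ind false q = sym (ℚ.*-zeroˡ q)
  rearrange : ∀ a b c → (a * b) * c ≡ b * (a * c)
  rearrange = solve-∀ ℚ-ring

-- `P d` as the part of degree `d` of `p`

ind-zeroRow : ∀ r → ind (does (zeroRow? r)) ≡ zʳ r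
ind-zeroRow []          = refl
ind-zeroRow (zero  ∷ r) = trans (ind-zeroRow r) (sym (ℚ.*-identityˡ (zʳ r)))
ind-zeroRow (suc a ∷ r) = sym (ℚ.*-zeroˡ (zʳ r))

ind-≈[] : ∀ r → ind (does (r ≈ʳ? [])) ≡ zʳ r
ind-≈[] []      = refl
ind-≈[] (a ∷ r) = ind-zeroRow (a ∷ r)

ind-≈ᵐ1 : ∀ m → ind (does (m ≈ᵐ? 1ᵐ)) ≡ zᵐ m
ind-≈ᵐ1 []      = refl
ind-≈ᵐ1 (r ∷ m) = ind-zeroRows (r ∷ m)
  where
  ind-zeroRows : ∀ m → ind (does (All.all? zeroRow? m)) ≡ zᵐ m
  ind-zeroRows []      = refl
  ind-zeroRows (r ∷ m) = trans (ind-∧ (does (zeroRow? r)) _)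
    (cong₂ _*_ (ind-zeroRow r) (ind-zeroRows m))

zeroRow?-∷ʳ : ∀ j e → does (zeroRow? (replicate j 0 ∷ʳ suc e)) ≡ false
zeroRow?-∷ʳ zero    e = refl
zeroRow?-∷ʳ (suc j) e = zeroRow?-∷ʳ j e

-- A leading zero excludes `j = 0` and shifts the other positions; a leading positive exponent
-- leaves only `j = 0` and forces the rest to vanish. The exponent is `suc e` because the zeroth
-- powers of all indeterminates coincide.
Σ-rows : ∀ i r w e → length r ≤ w →
         Σᴸ (upTo w) (λ j → ind (does (r ≈ʳ? (replicate j 0 ∷ʳ suc e)))) ≡
         ind (does (wt (λ _ → 1) id i r ℕ.≟ suc e)) * der (λ _ → 1) z₀ w₀ i r
Σ-rows i []      w e _ = Σᴸ-zero (upTo w) λ j → cong ind (zeroRow?-∷ʳ j e)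
Σ-rows i (zero ∷ r) (suc w) e (s≤s len) = begin
  Σᴸ (upTo (suc w)) (λ j → ind (does (zero ∷ r ≈ʳ? (replicate j 0 ∷ʳ suc e))))
    ≡⟨ Σᴸ-upTo-suc w (λ j → ind (does (zero ∷ r ≈ʳ? (replicate j 0 ∷ʳ suc e)))) ⟩
  0ℚ + Σᴸ (upTo w) (λ j → ind (does (r ≈ʳ? (replicate j 0 ∷ʳ suc e))))
    ≡⟨ cong (0ℚ +_) (Σ-rows (suc i) r w e len) ⟩
  0ℚ + d * u
    ≡⟨ rearrange d u (zʳ r) ⟩
  d * (1ℚ * (0ℚ * zʳ r) + 1ℚ * u) ∎
  where
  d = ind (does (wt (λ _ → 1) id (suc i) r ℕ.≟ suc e))
  u = der (λ _ → 1) z₀ w₀ (suc i) r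
  rearrange : ∀ d u z → 0ℚ + d * u ≡ d * (1ℚ * (0ℚ * z) + 1ℚ * u)
  rearrange = solve-∀ ℚ-ring
Σ-rows i (suc a ∷ r) (suc w) e (s≤s len) = begin
  Σᴸ (upTo (suc w)) (λ j → ind (does (suc a ∷ r ≈ʳ? (replicate j 0 ∷ʳ suc e))))
    ≡⟨ Σᴸ-upTo-suc w (λ j → ind (does (suc a ∷ r ≈ʳ? (replicate j 0 ∷ʳ suc e)))) ⟩
  ind (does (suc a ℕ.≟ suc e) ∧ does (r ≈ʳ? [])) + Σᴸ (upTo w) (λ _ → 0ℚ)
    ≡⟨ cong₂ _+_
         (trans (ind-∧ (does (suc a ℕ.≟ suc e)) _)
           (cong (ind (does (suc a ℕ.≟ suc e)) *_) (ind-≈[] r)))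
         (Σᴸ-0 (upTo w)) ⟩
  ind (does (suc a ℕ.≟ suc e)) * zʳ r + 0ℚ
    ≡⟨ cong (λ k → ind (does (k ℕ.≟ suc e)) * zʳ r + 0ℚ)
         (trans (ℕ.+-identityʳ (1 ℕ.* suc a)) (ℕ.*-identityˡ (suc a))) ⟨
  F 0 * zʳ r + 0ℚ
    -- Next to `zʳ r` the rest of the row has degree 0, so the test on the first exponent becomes
    -- the test on the whole row.
    ≡⟨ cong (_+ 0ℚ) (trans (ℚ.*-comm (F 0) (zʳ r)) (sym
         (IsCoalgebra.z-degree0 (isCoalgebraᴸ ℕ-isCoalgebra (λ _ → 1) (suc i)) r F))) ⟩
  zʳ r * F d + 0ℚ
    ≡⟨ rearrange (F d) u (zʳ r) ⟩
  F d * (1ℚ * (1ℚ * zʳ r) + 0ℚ * u) ∎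
  where
  F : ℕ → ℚ
  F d = ind (does (1 ℕ.* suc a ℕ.+ d ℕ.≟ suc e))
  d = wt (λ _ → 1) id (suc i) r
  u = der (λ _ → 1) z₀ w₀ (suc i) r
  rearrange : ∀ d u z → z * d + 0ℚ ≡ d * (1ℚ * (1ℚ * z) + 0ℚ * u)
  rearrange = solve-∀ ℚ-ring

-- The bound on `j` stays that of the whole monomial while the recursion removes rows, so `w` is a
-- parameter instead of the width of the remaining rows.
module _ (w : ℕ) where

  -- The coefficient at m of the sum of x_{k+1,j}ᵉ over all j ≤ w.
  powerSum : ℕ → ℕ → Monomial → ℚ
  powerSum k e m =
    Σᴸ (upTo w) (λ j → ind (does (m ≈ᵐ? (replicate k [] ∷ʳ (replicate j 0 ∷ʳ e)))))

  powerSum-[] : ∀ k e → powerSum k (suc e) [] ≡ 0ℚ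
  powerSum-[] k e = Σᴸ-zero (upTo w) λ j → cong ind (zeroRows?-∷ʳ k j)
    where
    zeroRows?-∷ʳ : ∀ k j →
      does (All.all? zeroRow? (replicate k [] ∷ʳ (replicate j 0 ∷ʳ suc e))) ≡ false
    zeroRows?-∷ʳ zero    j = cong (_∧ true) (zeroRow?-∷ʳ j e)
    zeroRows?-∷ʳ (suc k) j = zeroRows?-∷ʳ k j

  powerSum-zero : ∀ e r m → length r ≤ w →
    powerSum 0 (suc e) (r ∷ m) ≡ ind (does (degʳ r ℕ.≟ suc e)) * uʳ r * zᵐ m
  powerSum-zero e r m len = begin
    powerSum 0 (suc e) (r ∷ m)
      ≡⟨ Σᴸ-cong (upTo w) (λ j → trans (ind-∧ (does (r ≈ʳ? (replicate j 0 ∷ʳ suc e))) _)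
           (cong (ind (does (r ≈ʳ? (replicate j 0 ∷ʳ suc e))) *_) (ind-≈ᵐ1 m))) ⟩
    Σᴸ (upTo w) (λ j → ind (does (r ≈ʳ? (replicate j 0 ∷ʳ suc e))) * zᵐ m)
      ≡⟨ Σᴸ-*ʳ (zᵐ m) (upTo w) (λ j → ind (does (r ≈ʳ? (replicate j 0 ∷ʳ suc e)))) ⟩
    Σᴸ (upTo w) (λ j → ind (does (r ≈ʳ? (replicate j 0 ∷ʳ suc e)))) * zᵐ m
      ≡⟨ cong (_* zᵐ m) (Σ-rows 0 r w e len) ⟩
    ind (does (degʳ r ℕ.≟ suc e)) * uʳ r * zᵐ m ∎

  powerSum-suc : ∀ k e r m → powerSum (suc k) e (r ∷ m) ≡ zʳ r * powerSum k e m
  powerSum-suc k e r m = trans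
    (Σᴸ-cong (upTo w) λ j → trans (ind-∧ (does (r ≈ʳ? [])) _) (cong (_* _) (ind-≈[] r)))
    (Σᴸ-*ˡ (zʳ r) (upTo w)
      (λ j → ind (does (m ≈ᵐ? (replicate k [] ∷ʳ (replicate j 0 ∷ʳ e))))))

  -- The contribution of the divisor t + 1 of d to P d, for the monomials whose
  -- k-th row (from 0) is the row of the indeterminates of degree t + 1.
  term-P : ℕ → ℕ → ℕ → Monomial → ℚ
  term-P d t k m = ind (does (suc t ∣? d)) * (fromℕ (suc t) * powerSum k (d ℕ./ suc t) m)

  term-P-[] : ∀ d t k → term-P (suc d) t k [] ≡ 0ℚ
  term-P-[] d t k = by-cases (suc t ∣? suc d)
    where
    by-cases : (t∣d? : Dec (suc t ∣ suc d)) →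
      ind (does t∣d?) * (fromℕ (suc t) * powerSum k (suc d ℕ./ suc t) []) ≡ 0ℚ
    by-cases (no  _) = ℚ.*-zeroˡ (fromℕ (suc t) * powerSum k (suc d ℕ./ suc t) [])
    -- The quotient is positive because `suc d` is, which provides the positive exponent needed for
    -- `powerSum-[]`.
    by-cases (yes (divides (suc q) eq)) = begin
      1ℚ * (fromℕ (suc t) * powerSum k (suc d ℕ./ suc t) [])
        ≡⟨ cong (λ e → 1ℚ * (fromℕ (suc t) * powerSum k e []))
             (trans (cong (ℕ._/ suc t) eq) (m*n/n≡m (suc q) (suc t))) ⟩
      1ℚ * (fromℕ (suc t) * powerSum k (suc q) [])
        ≡⟨ cong (λ x → 1ℚ * (fromℕ (suc t) * x)) (powerSum-[] k q) ⟩
      1ℚ * (fromℕ (suc t) * 0ℚ)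
        ≡⟨ cong (1ℚ *_) (ℚ.*-zeroʳ (fromℕ (suc t))) ⟩
      0ℚ ∎

  -- That `suc t` divides `suc d` and the row has the quotient as its degree amounts to one equation
  -- on weighted degrees. The summand 0 is the degree of the other rows, which `zᵐ m` forces to
  -- vanish.
  term-P-zero : ∀ d t r m → length r ≤ w →
    term-P (suc d) t 0 (r ∷ m) ≡
    ind (does (suc t ℕ.* degʳ r ℕ.+ 0 ℕ.≟ suc d)) * (fromℕ (suc t) * (uʳ r * zᵐ m))
  term-P-zero d t r m len = by-cases (suc t ∣? suc d)
    where
    by-cases : (t∣d? : Dec (suc t ∣ suc d)) →
      ind (does t∣d?) * (fromℕ (suc t) * powerSum 0 (suc d ℕ./ suc t) (r ∷ m)) ≡
       ind (does (suc t ℕ.* degʳ r ℕ.+ 0 ℕ.≟ suc d)) * (fromℕ (suc t) * (uʳ r * zᵐ m))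
    by-cases (no t∤d) = begin
      0ℚ * (fromℕ (suc t) * powerSum 0 (suc d ℕ./ suc t) (r ∷ m))
        ≡⟨ ℚ.*-zeroˡ (fromℕ (suc t) * powerSum 0 (suc d ℕ./ suc t) (r ∷ m)) ⟩
      0ℚ
        ≡⟨ ℚ.*-zeroˡ (fromℕ (suc t) * (uʳ r * zᵐ m)) ⟨
      0ℚ * (fromℕ (suc t) * (uʳ r * zᵐ m))
        ≡⟨ cong (λ b → ind b * (fromℕ (suc t) * (uʳ r * zᵐ m)))
             (dec-false (suc t ℕ.* degʳ r ℕ.+ 0 ℕ.≟ suc d) λ eq → t∤d (divides (degʳ r)
               (trans (sym eq) (trans (ℕ.+-identityʳ _) (ℕ.*-comm (suc t) (degʳ r)))))) ⟨
      ind (does (suc t ℕ.* degʳ r ℕ.+ 0 ℕ.≟ suc d)) * (fromℕ (suc t) * (uʳ r * zᵐ m)) ∎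
    by-cases (yes (divides (suc q) eq)) = begin
      1ℚ * (fromℕ (suc t) * powerSum 0 (suc d ℕ./ suc t) (r ∷ m))
        ≡⟨ cong (λ e → 1ℚ * (fromℕ (suc t) * powerSum 0 e (r ∷ m)))
             (trans (cong (ℕ._/ suc t) eq) (m*n/n≡m (suc q) (suc t))) ⟩
      1ℚ * (fromℕ (suc t) * powerSum 0 (suc q) (r ∷ m))
        ≡⟨ cong (λ x → 1ℚ * (fromℕ (suc t) * x)) (powerSum-zero q r m len) ⟩
      1ℚ * (fromℕ (suc t) * (ind (does (degʳ r ℕ.≟ suc q)) * uʳ r * zᵐ m))
        ≡⟨ rearrange (fromℕ (suc t)) (ind (does (degʳ r ℕ.≟ suc q))) (uʳ r) (zᵐ m) ⟩
      ind (does (degʳ r ℕ.≟ suc q)) * (fromℕ (suc t) * (uʳ r * zᵐ m))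
        ≡⟨ cong (λ b → ind b * (fromℕ (suc t) * (uʳ r * zᵐ m)))
             (does-⇔ (mk⇔ to from) (degʳ r ℕ.≟ suc q) (suc t ℕ.* degʳ r ℕ.+ 0 ℕ.≟ suc d)) ⟩
      ind (does (suc t ℕ.* degʳ r ℕ.+ 0 ℕ.≟ suc d)) * (fromℕ (suc t) * (uʳ r * zᵐ m)) ∎
      where
      rearrange : ∀ k b u z → 1ℚ * (k * (b * u * z)) ≡ b * (k * (u * z))
      rearrange = solve-∀ ℚ-ring
      comm : suc t ℕ.* degʳ r ℕ.+ 0 ≡ degʳ r ℕ.* suc t
      comm = trans (ℕ.+-identityʳ _) (ℕ.*-comm (suc t) (degʳ r))
      to : degʳ r ≡ suc q → suc t ℕ.* degʳ r ℕ.+ 0 ≡ suc d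
      to deg≡q = trans comm (trans (cong (ℕ._* suc t) deg≡q) (sym eq))
      from : suc t ℕ.* degʳ r ℕ.+ 0 ≡ suc d → degʳ r ≡ suc q
      from eq′ = ℕ.*-cancelʳ-≡ (degʳ r) (suc q) (suc t) (trans (sym comm) (trans eq′ eq))

  -- Rows and candidate divisors are consumed in step: the first row of `m` belongs to the divisor
  -- `i + 1`, and `n` candidates are left. Once there are none, the remaining indeterminates have
  -- degree above `suc d`, and `p-low` makes the other side vanish.
  Σ-term-P : ∀ d i n m → i ℕ.+ n ≡ suc d → All (λ r → length r ≤ w) m →
    Σᴸ (upTo n) (λ k → term-P (suc d) (i ℕ.+ k) k m) ≡
    ind (does (wt id degʳ (suc i) m ℕ.≟ suc d)) * der id zʳ uʳ (suc i) m
  Σ-term-P d i zero m eq _ = by-cases (wt id degʳ (suc i) m ℕ.≟ suc d)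
    where
    by-cases : (deg≟ : Dec (wt id degʳ (suc i) m ≡ suc d)) →
               0ℚ ≡ ind (does deg≟) * der id zʳ uʳ (suc i) m
    by-cases (no  _)    = sym (ℚ.*-zeroˡ (der id zʳ uʳ (suc i) m))
    by-cases (yes deg≡) = sym (trans (ℚ.*-identityˡ _) (p-low (suc i) m
      (s≤s (ℕ.≤-reflexive (trans deg≡ (trans (sym eq) (ℕ.+-identityʳ i)))))))
  Σ-term-P d i (suc n) [] eq _ =
    trans (Σᴸ-zero (upTo (suc n)) λ k → term-P-[] d (i ℕ.+ k) k)
      (sym (ℚ.*-zeroʳ (ind (does (0 ℕ.≟ suc d)))))
  Σ-term-P d i (suc n) (r ∷ m) eq (len ∷ lens) = begin
    Σᴸ (upTo (suc n)) (λ k → term-P (suc d) (i ℕ.+ k) k (r ∷ m))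
      ≡⟨ Σᴸ-upTo-suc n (λ k → term-P (suc d) (i ℕ.+ k) k (r ∷ m)) ⟩
    term-P (suc d) (i ℕ.+ 0) 0 (r ∷ m) +
    Σᴸ (upTo n) (λ k → term-P (suc d) (i ℕ.+ suc k) (suc k) (r ∷ m))
      ≡⟨ cong₂ _+_
           (trans (cong (λ t → term-P (suc d) t 0 (r ∷ m)) (ℕ.+-identityʳ i))
             (term-P-zero d i r m len))
           (trans (Σᴸ-cong (upTo n) λ k → trans
             (cong (λ t → term-P (suc d) t (suc k) (r ∷ m)) (ℕ.+-suc i k))
             (pull (suc i ℕ.+ k) k))
             (Σᴸ-*ˡ (zʳ r) (upTo n) (λ k → term-P (suc d) (suc i ℕ.+ k) k m))) ⟩
    F 0 * (c * (uʳ r * zᵐ m)) +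
    zʳ r * Σᴸ (upTo n) (λ k → term-P (suc d) (suc i ℕ.+ k) k m)
      ≡⟨ cong₂ _+_ (rearrange (F 0) c (uʳ r) (zᵐ m))
           (cong (zʳ r *_) (Σ-term-P d (suc i) n m (trans (sym (ℕ.+-suc i n)) eq) lens)) ⟩
    c * uʳ r * (zᵐ m * F 0) +
    zʳ r * (ind (does (wt id degʳ (suc (suc i)) m ℕ.≟ suc d)) * q)
      -- In the first summand `zᵐ m` puts the later rows in degree 0, in the second `zʳ r` does so
      -- for the first row. Both tests thus become the test on the whole degree, which factors out.
      ≡⟨ cong₂ _+_
           (cong (c * uʳ r *_) (sym
             (z-degree0ᴸ row-isCoalgebra id (suc (suc i)) m F)))
           (trans (cong (λ k → zʳ r * (ind (does (k ℕ.+ wt id degʳ (suc (suc i)) m ℕ.≟ suc d)) * q))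
               (sym (ℕ.*-zeroʳ (suc i))))
             (trans (pull-front (zʳ r) (G 0) q) (trans
               (cong (q *_) (sym (IsCoalgebra.z-degree0 row-isCoalgebra r G)))
               (swap q (zʳ r) (G (degʳ r)))))) ⟩
    c * uʳ r * (zᵐ m * F (wt id degʳ (suc (suc i)) m)) +
    zʳ r * (q * G (degʳ r))
      ≡⟨ collect c (uʳ r) (zᵐ m) (G (degʳ r)) (zʳ r) q ⟩
    G (degʳ r) * (c * (uʳ r * zᵐ m) + zʳ r * q) ∎
    where
    c = fromℕ (suc i)
    q = der id zʳ uʳ (suc (suc i)) m
    F G : ℕ → ℚ
    F k = ind (does (suc i ℕ.* degʳ r ℕ.+ k ℕ.≟ suc d))
    G k = ind (does (suc i ℕ.* k ℕ.+ wt id degʳ (suc (suc i)) m ℕ.≟ suc d))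
    pull : ∀ t k → term-P (suc d) t (suc k) (r ∷ m) ≡ zʳ r * term-P (suc d) t k m
    pull t k = trans
      (cong (λ x → ind (does (suc t ∣? suc d)) * (fromℕ (suc t) * x))
        (powerSum-suc k (suc d ℕ./ suc t) r m))
      (front (ind (does (suc t ∣? suc d))) (fromℕ (suc t)) (zʳ r) _)
      where
      front : ∀ a b c d → a * (b * (c * d)) ≡ c * (a * (b * d))
      front = solve-∀ ℚ-ring
    rearrange : ∀ f c u z → f * (c * (u * z)) ≡ c * u * (z * f)
    rearrange = solve-∀ ℚ-ring
    pull-front : ∀ a b c → a * (b * c) ≡ c * (a * b)
    pull-front = solve-∀ ℚ-ring
    swap : ∀ a b c → a * (b * c) ≡ b * (a * c)
    swap = solve-∀ ℚ-ring
    collect : ∀ c u z g y q → c * u * (z * g) + y * (q * g) ≡ g * (c * (u * z) + y * q)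
    collect = solve-∀ ℚ-ring

length≤width : ∀ m → All (λ r → length r ≤ width m) m
length≤width m = All.map⁻ (xs≤max 0 (map length m))

P≡ : ∀ d m → P d m ≡ ind (does (degᵐ m ℕ.≟ val d)) * p m
P≡ d@(pos (suc n)) m = begin
  P d m
    ≡⟨ Σᴸ-filter (λ k → val k ∣? suc n) (range⁺ (suc n)) _ ⟩
  Σᴸ (range⁺ (suc n)) (λ k → ind (does (val k ∣? suc n)) * f k)
    ≡⟨ Σᴸ-map (λ k → pos (suc k)) (upTo (suc n)) (λ k → ind (does (val k ∣? suc n)) * f k) ⟩
  Σᴸ (upTo (suc n)) (λ k → ind (does (suc k ∣? suc n)) * f (pos (suc k)))
    ≡⟨ Σᴸ-cong (upTo (suc n)) (λ k → cong (ind (does (suc k ∣? suc n)) *_)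
         (trans (Σᴸ-map (λ j → pos (suc j)) (upTo (width m))
             (λ j → fromℕ (suc k) * ⟦ x[ pos (suc k) , j ]^ (suc n ℕ./ suc k) ⟧ m))
           (Σᴸ-*ˡ (fromℕ (suc k)) (upTo (width m)) _))) ⟩
  Σᴸ (upTo (suc n)) (λ k → term-P (width m) (suc n) k k m)
    ≡⟨ Σ-term-P (width m) n 0 (suc n) m refl (length≤width m) ⟩
  ind (does (degᵐ m ℕ.≟ suc n)) * p m ∎
  where
  f : ℕ⁺ → ℚ
  f k = ∑∞ (λ j → fromℕ (val k) · ⟦ x[ k , j ]^ (suc n ℕ./ val k) ⟧) m

-- The part of degree 0 of `ε`

-- Positive weights make a list have degree 0 exactly when its head and tail do. For `ε` this yields
-- the base case `E 0 ≈ 1ˢ`.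
counit-indᴸ : ∀ {n : A → ℕ} {z e : A → ℚ} →
              (∀ x → z x ≡ ind (does (n x ℕ.≟ 0)) * e x) →
              ∀ {c} → (∀ i → c i ≤ c (suc i)) → ∀ i → 0 < c i → ∀ xs →
              Prod z xs ≡ ind (does (wt c n i xs ℕ.≟ 0)) * Prod e xs
counit-indᴸ z≡ mono i 0<c [] = refl
counit-indᴸ {n = n} {z} {e} z≡ {c} mono i 0<c (x ∷ xs) = begin
  z x * Prod z xs
    ≡⟨ cong₂ _*_ (z≡ x) (counit-indᴸ z≡ mono (suc i) (ℕ.<-≤-trans 0<c (mono i)) xs) ⟩
  (ind (does n≟0) * e x) * (ind (does w≟0) * Prod e xs)
    ≡⟨ *-interchange (ind (does n≟0)) (e x) (ind (does w≟0)) (Prod e xs) ⟩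
  (ind (does n≟0) * ind (does w≟0)) * (e x * Prod e xs)
    ≡⟨ cong (_* (e x * Prod e xs)) (trans (sym (ind-∧ (does n≟0) (does w≟0)))
         (cong ind (does-⇔ (mk⇔ to from) (n≟0 ×-dec w≟0) (wt c n i (x ∷ xs) ℕ.≟ 0)))) ⟩
  ind (does (wt c n i (x ∷ xs) ℕ.≟ 0)) * (e x * Prod e xs) ∎
  where
  w = wt c n (suc i) xs
  n≟0 = n x ℕ.≟ 0
  w≟0 = w ℕ.≟ 0
  to : n x ≡ 0 × w ≡ 0 → c i ℕ.* n x ℕ.+ w ≡ 0
  to (n≡0 , w≡0) = trans (cong₂ (λ a b → c i ℕ.* a ℕ.+ b) n≡0 w≡0)
    (trans (ℕ.+-identityʳ (c i ℕ.* 0)) (ℕ.*-zeroʳ (c i)))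
  from : c i ℕ.* n x ℕ.+ w ≡ 0 → n x ≡ 0 × w ≡ 0
  from eq with ℕ.m*n≡0⇒m≡0∨n≡0 (c i) (ℕ.m+n≡0⇒m≡0 (c i ℕ.* n x) eq)
  ... | inj₁ c≡0 = ⊥-elim (ℕ.<⇒≢ 0<c (sym c≡0))
  ... | inj₂ n≡0 = n≡0 , ℕ.m+n≡0⇒n≡0 (c i ℕ.* n x) eq

zᵐ≡ : ∀ m → zᵐ m ≡ ind (does (degᵐ m ℕ.≟ 0)) * ε m
zᵐ≡ = counit-indᴸ
  (counit-indᴸ (λ { 0 → refl ; 1 → refl ; (suc (suc _)) → refl }) (λ _ → ℕ.≤-refl) 0 ℕ.z<s)
  ℕ.n≤1+n 1 ℕ.z<s

-- The convolution product of series

⊛-cong : ∀ {f f′ g g′ : Series} → f ≈ f′ → g ≈ g′ → f ⊛ g ≈ f′ ⊛ g′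
⊛-cong f≈f′ g≈g′ m = ∫-cong splits m λ a b → cong₂ _*_ (f≈f′ a) (g≈g′ b)

⊛-assoc : ∀ f g h → (f ⊛ g) ⊛ h ≈ f ⊛ (g ⊛ h)
⊛-assoc f g h m = begin
  ∫ splits m (λ a b → ∫ splits a (λ c d → f c * g d) * h b)
    ≡⟨ ∫-cong splits m (λ a b → ∫-*ʳ splits a (h b) (λ c d → f c * g d)) ⟨
  ∫ splits m (λ a b → ∫ splits a (λ c d → f c * g d * h b))
    ≡⟨ IsCoalgebra.coassoc monomial-isCoalgebra m (λ c d b → f c * g d * h b) ⟩
  ∫ splits m (λ a b → ∫ splits b (λ c d → f a * g c * h d))
    ≡⟨ ∫-cong splits m (λ a b → trans
         (∫-cong splits b λ c d → ℚ.*-assoc (f a) (g c) (h d))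
         (∫-*ˡ splits b (f a) (λ c d → g c * h d))) ⟩
  ∫ splits m (λ a b → f a * ∫ splits b (λ c d → g c * h d)) ∎

⊛-identityˡ : ∀ f → 1ˢ ⊛ f ≈ f
⊛-identityˡ f m = trans (∫-cong splits m λ a b → cong (_* f b) (ind-≈ᵐ1 a))
  (IsCoalgebra.counitˡ monomial-isCoalgebra m f)

⊛-identityʳ : ∀ f → f ⊛ 1ˢ ≈ f
⊛-identityʳ f m = trans (∫-cong splits m λ a b → cong (f a *_) (ind-≈ᵐ1 b))
  (IsCoalgebra.counitʳ monomial-isCoalgebra m f)

-- Products and coefficients attached to a composition

P-block-1 : ∀ d → P-block (d , 1⁺) ≈ P d
P-block-1 d m = begin
  P-block (d , 1⁺) m
    ≡⟨ cong (λ b → if b then P d (map (map (ℕ._/ 1)) m) else 0ℚ)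
         (dec-true (All.all? (All.all? (1 ∣?_)) m) (All.universal (All.universal 1∣_) m)) ⟩
  P d (map (map (ℕ._/ 1)) m)
    ≡⟨ cong (P d) (trans (map-cong (λ r → trans (map-cong n/1≡n r) (map-id r)) m) (map-id m)) ⟩
  P d m ∎

-- `∏` folds from the right, but the recursion removes the last part; this is where associativity of
-- `⊛` enters.
∏-snoc : ∀ α k → ∏ (α ∷ʳ k) P ≈ ∏ α P ⊛ P k
∏-snoc []      k m = trans (⊛-identityʳ (P k) m) (sym (⊛-identityˡ (P k) m))
∏-snoc (a ∷ α) k m = trans (⊛-cong {P a} {P a} (λ _ → refl) (∏-snoc α k) m)
  (sym (⊛-assoc (P a) (∏ α P) (P k) m))

Pδ-⟨⟩¹ : ∀ α → Pδ (α ∷ []) ≈ ∏ α P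
Pδ-⟨⟩¹ []      m = refl
Pδ-⟨⟩¹ (a ∷ α) m = ⊛-cong (P-block-1 a) (Pδ-⟨⟩¹ α) m

Z-from-∷ʳ : ∀ s α k →
  val (Z-from s (α ∷ʳ k)) ≡ val (Z-from s α) ℕ.* (s ℕ.+ (∣ α ∣ ℕ.+ val k))
Z-from-∷ʳ s []      k = ℕ.*-comm (s ℕ.+ val k) 1
Z-from-∷ʳ s (a ∷ α) k = trans
  (cong ((s ℕ.+ val a) ℕ.*_) (Z-from-∷ʳ (s ℕ.+ val a) α k))
  (rearrange s (val a) (val (Z-from (s ℕ.+ val a) α)) ∣ α ∣ (val k))
  where
  rearrange : ∀ s a z n k → (s ℕ.+ a) ℕ.* (z ℕ.* (s ℕ.+ a ℕ.+ (n ℕ.+ k))) ≡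
                            (s ℕ.+ a) ℕ.* z ℕ.* (s ℕ.+ (a ℕ.+ n ℕ.+ k))
  rearrange = ℕ-solve-∀

coef : Composition → ℚ
coef α = (-1ℤ ℤ.^ length α) /⁺ Z α

coef-∷ʳ : ∀ α k → fromℕ (∣ α ∣ ℕ.+ val k) * coef (α ∷ʳ k) ≡ - coef α
coef-∷ʳ α k = trans
  (cong (λ l → fromℕ (∣ α ∣ ℕ.+ val k) * ((-1ℤ ℤ.^ l) /⁺ Z (α ∷ʳ k)))
    (trans (length-++ α) (ℕ.+-comm (length α) 1)))
  (/⁺-cancel (-1ℤ ℤ.^ length α) (Z α) (Z (α ∷ʳ k)) (∣ α ∣ ℕ.+ val k) (Z-from-∷ʳ 0 α k))

term : Composition → Series
term α = coef α · ∏ α P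

Q : ℕ → Series
Q d = ∑ (compositions d) term

Q-⊛ : ∀ d g m → (Q d ⊛ g) m ≡ Σᴸ (compositions d) (λ α → coef α * (∏ α P ⊛ g) m)
Q-⊛ d g m = begin
  ∫ splits m (λ a b → Σᴸ (compositions d) (λ α → coef α * ∏ α P a) * g b)
    ≡⟨ ∫-cong splits m (λ a b → trans
         (sym (Σᴸ-*ʳ (g b) (compositions d) (λ α → coef α * ∏ α P a)))
         (Σᴸ-cong (compositions d) λ α → ℚ.*-assoc (coef α) (∏ α P a) (g b))) ⟩
  ∫ splits m (λ a b → Σᴸ (compositions d) (λ α → coef α * (∏ α P a * g b)))
    ≡⟨ Σᴸ-swap (splits m) (compositions d) (λ (a , b) α → coef α * (∏ α P a * g b)) ⟩
  Σᴸ (compositions d) (λ α → ∫ splits m (λ a b → coef α * (∏ α P a * g b)))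
    ≡⟨ Σᴸ-cong (compositions d) (λ α → ∫-*ˡ splits m (coef α) (λ a b → ∏ α P a * g b)) ⟩
  Σᴸ (compositions d) (λ α → coef α * (∏ α P ⊛ g) m) ∎

Σ-last-part : ∀ d k m → fromℕ (d ℕ.+ val k) * Σᴸ (compositions d) (λ α → term (α ∷ʳ k) m) ≡
                        - (Q d ⊛ P k) m
Σ-last-part d k m = begin
  fromℕ (d ℕ.+ val k) * Σᴸ (compositions d) (λ α → term (α ∷ʳ k) m)
    ≡⟨ Σᴸ-*ˡ (fromℕ (d ℕ.+ val k)) (compositions d) (λ α → term (α ∷ʳ k) m) ⟨
  Σᴸ (compositions d) (λ α → fromℕ (d ℕ.+ val k) * term (α ∷ʳ k) m)
    -- Membership supplies `∣ α ∣ ≡ d`, which identifies the common factor with the last factor of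
    -- `Z (α ∷ʳ k)`.
    ≡⟨ Σᴸ-cong-∈ (compositions d) (λ {α} α∈ → step α (Equivalence.to (∈-compositions d) α∈)) ⟩
  Σᴸ (compositions d) (λ α → - 1ℚ * (coef α * (∏ α P ⊛ P k) m))
    ≡⟨ Σᴸ-*ˡ (- 1ℚ) (compositions d) (λ α → coef α * (∏ α P ⊛ P k) m) ⟩
  - 1ℚ * Σᴸ (compositions d) (λ α → coef α * (∏ α P ⊛ P k) m)
    ≡⟨ cong (- 1ℚ *_) (Q-⊛ d (P k) m) ⟨
  - 1ℚ * (Q d ⊛ P k) m
    ≡⟨ ℚ.neg-distribˡ-* 1ℚ ((Q d ⊛ P k) m) ⟨
  - (1ℚ * (Q d ⊛ P k) m)
    ≡⟨ cong -_ (ℚ.*-identityˡ ((Q d ⊛ P k) m)) ⟩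
  - (Q d ⊛ P k) m ∎
  where
  neg : ∀ a b → - a * b ≡ - 1ℚ * (a * b)
  neg = solve-∀ ℚ-ring
  step : ∀ α → ∣ α ∣ ≡ d →
         fromℕ (d ℕ.+ val k) * term (α ∷ʳ k) m ≡ - 1ℚ * (coef α * (∏ α P ⊛ P k) m)
  step α refl = begin
    fromℕ (∣ α ∣ ℕ.+ val k) * (coef (α ∷ʳ k) * ∏ (α ∷ʳ k) P m)
      ≡⟨ ℚ.*-assoc (fromℕ (∣ α ∣ ℕ.+ val k)) (coef (α ∷ʳ k)) (∏ (α ∷ʳ k) P m) ⟨
    fromℕ (∣ α ∣ ℕ.+ val k) * coef (α ∷ʳ k) * ∏ (α ∷ʳ k) P m
      ≡⟨ cong₂ _*_ (coef-∷ʳ α k) (∏-snoc α k m) ⟩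
    - coef α * (∏ α P ⊛ P k) m
      ≡⟨ neg (coef α) ((∏ α P ⊛ P k) m) ⟩
    - 1ℚ * (coef α * (∏ α P ⊛ P k) m) ∎

-- Newton's identity through truncated sums

⟪_≟_⟫ ⟪_≤?_⟫ : ℕ → ℕ → ℚ
⟪ a ≟ b ⟫ = ind (does (a ℕ.≟ b))
⟪ a ≤? b ⟫ = ind (does (a ℕ.≤? b))

ind-⇔ : ∀ {X Y : Set} → (X → Y) → (Y → X) → (x? : Dec X) (y? : Dec Y) →
        ind (does x?) ≡ ind (does y?)
ind-⇔ f g x? y? = cong ind (does-⇔ (mk⇔ f g) x? y?)

ind-true : ∀ {X : Set} (x? : Dec X) → X → ind (does x?) ≡ 1ℚ
ind-true x? x = cong ind (dec-true x? x)

ind-false : ∀ {X : Set} (x? : Dec X) → ¬ X → ind (does x?) ≡ 0ℚ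
ind-false x? ¬x = cong ind (dec-false x? ¬x)

-- If `a + b = k` and `k ≤ b`, then `a = 0`: a truncated sum of total degree `k` has a single
-- summand.
ind-first : ∀ a b k → ⟪ a ≟ 0 ⟫ * ⟪ b ≟ k ⟫ ≡ ⟪ a ℕ.+ b ≟ k ⟫ * ⟪ k ≤? b ⟫
ind-first a b k = begin
  ⟪ a ≟ 0 ⟫ * ⟪ b ≟ k ⟫
    ≡⟨ ind-∧ (does (a ℕ.≟ 0)) (does (b ℕ.≟ k)) ⟨
  ind (does (a ℕ.≟ 0 ×-dec b ℕ.≟ k))
    ≡⟨ ind-⇔ (λ { (refl , refl) → refl , ℕ.≤-refl }) from
         (a ℕ.≟ 0 ×-dec b ℕ.≟ k) (a ℕ.+ b ℕ.≟ k ×-dec k ℕ.≤? b) ⟩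
  ind (does (a ℕ.+ b ℕ.≟ k ×-dec k ℕ.≤? b))
    ≡⟨ ind-∧ (does (a ℕ.+ b ℕ.≟ k)) (does (k ℕ.≤? b)) ⟩
  ⟪ a ℕ.+ b ≟ k ⟫ * ⟪ k ≤? b ⟫ ∎
  where
  from : a ℕ.+ b ≡ k × k ≤ b → a ≡ 0 × b ≡ k
  from (refl , a+b≤b) = a≡0 , sym (cong (ℕ._+ b) a≡0)
    where
    a≡0 = ℕ.n≤0⇒n≡0 (ℕ.+-cancelʳ-≤ b a 0 a+b≤b)

-- The condition `k ≤ b` splits into `b = k`, where the total degree fixes `a = n`, and `k < b`.
-- This peels one summand off a truncated sum.
ind-step : ∀ a b n k → ⟪ a ≟ n ⟫ * ⟪ b ≟ k ⟫ + ⟪ a ℕ.+ b ≟ n ℕ.+ k ⟫ * ⟪ suc k ≤? b ⟫ ≡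
                       ⟪ a ℕ.+ b ≟ n ℕ.+ k ⟫ * ⟪ k ≤? b ⟫
ind-step a b n k = by-cases (b ℕ.≟ k)
  where
  N = ⟪ a ℕ.+ b ≟ n ℕ.+ k ⟫
  lemma-yes : ∀ x → x * 1ℚ + x * 0ℚ ≡ x * 1ℚ
  lemma-yes = solve-∀ ℚ-ring
  lemma-no : ∀ x y z → x * 0ℚ + y * z ≡ y * z
  lemma-no = solve-∀ ℚ-ring
  by-cases : Dec (b ≡ k) → ⟪ a ≟ n ⟫ * ⟪ b ≟ k ⟫ + N * ⟪ suc k ≤? b ⟫ ≡ N * ⟪ k ≤? b ⟫
  by-cases (yes refl) = begin
    ⟪ a ≟ n ⟫ * ⟪ b ≟ b ⟫ + N * ⟪ suc b ≤? b ⟫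
      ≡⟨ cong₂ _+_
           (cong₂ _*_ (ind-⇔ (cong (ℕ._+ b)) (ℕ.+-cancelʳ-≡ b a n) (a ℕ.≟ n) (a ℕ.+ b ℕ.≟ n ℕ.+ b))
             (ind-true (b ℕ.≟ b) refl))
           (cong (N *_) (ind-false (suc b ℕ.≤? b) (ℕ.n≮n b))) ⟩
    N * 1ℚ + N * 0ℚ
      ≡⟨ lemma-yes N ⟩
    N * 1ℚ
      ≡⟨ cong (N *_) (ind-true (b ℕ.≤? b) ℕ.≤-refl) ⟨
    N * ⟪ b ≤? b ⟫ ∎
  by-cases (no b≢k) = begin
    ⟪ a ≟ n ⟫ * ⟪ b ≟ k ⟫ + N * ⟪ suc k ≤? b ⟫
      ≡⟨ cong₂ (λ x y → ⟪ a ≟ n ⟫ * x + N * y) (ind-false (b ℕ.≟ k) b≢k)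
           (ind-⇔ ℕ.<⇒≤ (λ k≤b → ℕ.≤∧≢⇒< k≤b (b≢k ∘ sym)) (suc k ℕ.≤? b) (k ℕ.≤? b)) ⟩
    ⟪ a ≟ n ⟫ * 0ℚ + N * ⟪ k ≤? b ⟫
      ≡⟨ lemma-no ⟪ a ≟ n ⟫ N ⟪ k ≤? b ⟫ ⟩
    N * ⟪ k ≤? b ⟫ ∎

-- The sum of E (n − i) ⊛ P (k + i) over 0 ≤ i ≤ n.
EP : ℕ → ℕ → Series
EP n k m = ∫ splits m (λ a b →
  ⟪ degᵐ a ℕ.+ degᵐ b ≟ n ℕ.+ k ⟫ * ⟪ k ≤? degᵐ b ⟫ * (ε a * p b))

E⊛P : ∀ n k m → (E n ⊛ P k) m ≡
      ∫ splits m (λ a b → ⟪ degᵐ a ≟ n ⟫ * ⟪ degᵐ b ≟ val k ⟫ * (ε a * p b))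
E⊛P n k m = ∫-cong splits m λ a b → trans (cong₂ _*_ (E≡ n a) (P≡ k b))
  (*-interchange ⟪ degᵐ a ≟ n ⟫ (ε a) ⟪ degᵐ b ≟ val k ⟫ (p b))

EP-zero : ∀ k → E 0 ⊛ P k ≈ EP 0 (val k)
EP-zero k m = trans (E⊛P 0 k m)
  (∫-cong splits m λ a b → cong (_* (ε a * p b)) (ind-first (degᵐ a) (degᵐ b) (val k)))

EP-suc : ∀ n k m → (E (suc n) ⊛ P k) m + EP n (suc (val k)) m ≡ EP (suc n) (val k) m
EP-suc n k m = begin
  (E (suc n) ⊛ P k) m + EP n (suc (val k)) m
    ≡⟨ cong₂ _+_ (E⊛P (suc n) k m)
         (∫-cong splits m λ a b →
           cong (λ N → ⟪ degᵐ a ℕ.+ degᵐ b ≟ N ⟫ * ⟪ suc (val k) ≤? degᵐ b ⟫ * (ε a * p b))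
             (ℕ.+-suc n (val k))) ⟩
  ∫ splits m F + ∫ splits m G
    ≡⟨ ∫-+ splits m F G ⟨
  ∫ splits m (λ a b → F a b + G a b)
    ≡⟨ ∫-cong splits m (λ a b → trans
         (sym (ℚ.*-distribʳ-+ (ε a * p b) (⟪ degᵐ a ≟ suc n ⟫ * ⟪ degᵐ b ≟ val k ⟫) _))
         (cong (_* (ε a * p b)) (ind-step (degᵐ a) (degᵐ b) (suc n) (val k)))) ⟩
  EP (suc n) (val k) m ∎
  where
  F G : Monomial → Monomial → ℚ
  F a b = ⟪ degᵐ a ≟ suc n ⟫ * ⟪ degᵐ b ≟ val k ⟫ * (ε a * p b)
  G a b = ⟪ degᵐ a ℕ.+ degᵐ b ≟ suc n ℕ.+ val k ⟫ * ⟪ suc (val k) ≤? degᵐ b ⟫ * (ε a * p b)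

-- `p` has no constant term, so the bound `1 ≤ degᵐ b` removes nothing. What remains is the part of
-- degree `suc n` of `ε ⊛ p`: gradedness moves the degree test out of the sum, and `logDeriv`
-- evaluates it.
newton : ∀ n → EP n 1 ≈ (- fromℕ (suc n)) · E (suc n)
newton n m = begin
  ∫ splits m (λ a b → ⟪ degᵐ a ℕ.+ degᵐ b ≟ n ℕ.+ 1 ⟫ * ⟪ 1 ≤? degᵐ b ⟫ * (ε a * p b))
    ≡⟨ ∫-cong splits m (λ a b → simplify (degᵐ a) (ε a) b) ⟩
  ∫ splits m (λ a b → ⟪ degᵐ a ℕ.+ degᵐ b ≟ suc n ⟫ * (ε a * p b))
    ≡⟨ IsCoalgebra.graded monomial-isCoalgebra m (λ d a b → ⟪ d ≟ suc n ⟫ * (ε a * p b)) ⟩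
  ∫ splits m (λ a b → ⟪ degᵐ m ≟ suc n ⟫ * (ε a * p b))
    ≡⟨ ∫-*ˡ splits m ⟪ degᵐ m ≟ suc n ⟫ (λ a b → ε a * p b) ⟩
  ⟪ degᵐ m ≟ suc n ⟫ * ∫ splits m (λ a b → ε a * p b)
    ≡⟨ cong (⟪ degᵐ m ≟ suc n ⟫ *_) (logDeriv m) ⟩
  ⟪ degᵐ m ≟ suc n ⟫ * - (fromℕ (degᵐ m) * ε m)
    ≡⟨ subst-degree (degᵐ m ℕ.≟ suc n) ⟩
  ⟪ degᵐ m ≟ suc n ⟫ * - (fromℕ (suc n) * ε m)
    ≡⟨ rearrange ⟪ degᵐ m ≟ suc n ⟫ (fromℕ (suc n)) (ε m) ⟩
  - fromℕ (suc n) * (⟪ degᵐ m ≟ suc n ⟫ * ε m)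
    ≡⟨ cong (- fromℕ (suc n) *_) (E≡ (suc n) m) ⟨
  - fromℕ (suc n) * E (suc n) m ∎
  where
  rearrange : ∀ a b c → a * - (b * c) ≡ - b * (a * c)
  rearrange = solve-∀ ℚ-ring
  regroup : ∀ a b c d → a * b * (c * d) ≡ a * (c * (b * d))
  regroup = solve-∀ ℚ-ring
  ind-p : ∀ b → Dec (1 ≤ degᵐ b) → ⟪ 1 ≤? degᵐ b ⟫ * p b ≡ p b
  ind-p b (yes 1≤d) = trans (cong (_* p b) (ind-true (1 ℕ.≤? degᵐ b) 1≤d)) (ℚ.*-identityˡ (p b))
  ind-p b (no  1≰d) = trans (cong (⟪ 1 ≤? degᵐ b ⟫ *_) p≡0)
    (trans (ℚ.*-zeroʳ ⟪ 1 ≤? degᵐ b ⟫) (sym p≡0))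
    where
    p≡0 = p-low 1 b (ℕ.≰⇒> 1≰d)
  simplify : ∀ a x b → ⟪ a ℕ.+ degᵐ b ≟ n ℕ.+ 1 ⟫ * ⟪ 1 ≤? degᵐ b ⟫ * (x * p b) ≡
                   ⟪ a ℕ.+ degᵐ b ≟ suc n ⟫ * (x * p b)
  simplify a x b = trans
    (regroup ⟪ a ℕ.+ degᵐ b ≟ n ℕ.+ 1 ⟫ ⟪ 1 ≤? degᵐ b ⟫ x (p b))
    (cong₂ (λ N q → ⟪ a ℕ.+ degᵐ b ≟ N ⟫ * (x * q)) (ℕ.+-comm n 1) (ind-p b (1 ℕ.≤? degᵐ b)))
  subst-degree : (deg≟ : Dec (degᵐ m ≡ suc n)) →
    ind (does deg≟) * - (fromℕ (degᵐ m) * ε m) ≡ ind (does deg≟) * - (fromℕ (suc n) * ε m)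
  subst-degree (yes eq) = cong (λ d → 1ℚ * - (fromℕ d * ε m)) eq
  subst-degree (no _)   = trans (ℚ.*-zeroˡ (- (fromℕ (degᵐ m) * ε m)))
    (sym (ℚ.*-zeroˡ (- (fromℕ (suc n) * ε m))))

-- The recursion over compositions

-- All compositions enumerated here have the same size `n + val k`, so one factor clears the last
-- factor of every `Z`. The bound `k` is general because the enumeration recurses on it; prefixes
-- have size at most `n`, where `Q` is already known.
Σ-compositions-from : ∀ k n → (∀ {j} → j ≤ n → Q j ≈ E j) → ∀ m →
  fromℕ (n ℕ.+ val k) * ∑ (compositions-from k n) term m ≡ - EP n (val k) m
Σ-compositions-from k zero    Q≈E m = begin
  fromℕ (val k) * ∑ (compositions-from k zero) term m
    ≡⟨ Σ-last-part 0 k m ⟩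
  - (Q 0 ⊛ P k) m
    ≡⟨ cong -_ (⊛-cong {g = P k} {P k} (Q≈E z≤n) (λ _ → refl) m) ⟩
  - (E 0 ⊛ P k) m
    ≡⟨ cong -_ (EP-zero k m) ⟩
  - EP 0 (val k) m ∎
Σ-compositions-from k (suc n) Q≈E m = begin
  fromℕ N * Σᴸ (map (_∷ʳ k) (compositions (suc n)) ++ compositions-from (suc⁺ k) n) t
    ≡⟨ cong (fromℕ N *_) (trans (Σᴸ-++ (map (_∷ʳ k) (compositions (suc n))) _ t)
         (cong (_+ Σᴸ (compositions-from (suc⁺ k) n) t)
           (Σᴸ-map (_∷ʳ k) (compositions (suc n)) t))) ⟩
  fromℕ N * (Σᴸ (compositions (suc n)) (t ∘ (_∷ʳ k)) + Σᴸ (compositions-from (suc⁺ k) n) t)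
    ≡⟨ ℚ.*-distribˡ-+ (fromℕ N) _ _ ⟩
  fromℕ N * Σᴸ (compositions (suc n)) (t ∘ (_∷ʳ k)) +
  fromℕ N * Σᴸ (compositions-from (suc⁺ k) n) t
    -- Compositions ending in exactly `k` give one Newton summand. For the others the bound rises by
    -- one and `n` drops by one, which keeps the total.
    ≡⟨ cong₂ _+_
         (trans (Σ-last-part (suc n) k m)
           (cong -_ (⊛-cong {g = P k} {P k} (Q≈E ℕ.≤-refl) (λ _ → refl) m)))
         (trans (cong (λ d → fromℕ d * Σᴸ (compositions-from (suc⁺ k) n) t)
             (sym (ℕ.+-suc n (val k))))
           (Σ-compositions-from (suc⁺ k) n (Q≈E ∘ ℕ.m≤n⇒m≤1+n) m)) ⟩
  - (E (suc n) ⊛ P k) m + - EP n (suc (val k)) m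
    ≡⟨ ℚ.neg-distrib-+ ((E (suc n) ⊛ P k) m) (EP n (suc (val k)) m) ⟨
  - ((E (suc n) ⊛ P k) m + EP n (suc (val k)) m)
    ≡⟨ cong -_ (EP-suc n k m) ⟩
  - EP (suc n) (val k) m ∎
  where
  N = suc n ℕ.+ val k
  t : Composition → ℚ
  t α = term α m

fromℕ-cancel : ∀ n {x y} → fromℕ (suc n) * x ≡ fromℕ (suc n) * y → x ≡ y
fromℕ-cancel n eq = ℚ.≤-antisym
  (ℚ.*-cancelˡ-≤-pos (fromℕ (suc n)) (ℚ.≤-reflexive eq))
  (ℚ.*-cancelˡ-≤-pos (fromℕ (suc n)) (ℚ.≤-reflexive (sym eq)))
  where
  instance
    positive : ℚ.Positive (fromℕ (suc n))
    positive = ℚ.normalize-pos (suc n) 1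

-- The bound `n` turns strong induction on `d` into structural recursion, since the recursion needs
-- all smaller degrees at once.
Q≈E : ∀ n {d} → d ≤ n → Q d ≈ E d
Q≈E n       {zero}  _         m = begin
  1ℚ * 1ˢ m + 0ℚ                    ≡⟨ trans (ℚ.+-identityʳ (1ℚ * 1ˢ m)) (ℚ.*-identityˡ (1ˢ m)) ⟩
  1ˢ m                              ≡⟨ ind-≈ᵐ1 m ⟩
  zᵐ m                              ≡⟨ zᵐ≡ m ⟩
  ⟪ degᵐ m ≟ 0 ⟫ * ε m              ≡⟨ E≡ 0 m ⟨
  E 0 m                             ∎
Q≈E (suc n) {suc d} (s≤s d≤n) m = fromℕ-cancel d (begin
  fromℕ (suc d) * Q (suc d) m
    ≡⟨ cong (λ k → fromℕ k * Q (suc d) m) (ℕ.+-comm 1 d) ⟩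
  fromℕ (d ℕ.+ 1) * Q (suc d) m
    -- With the bound 1 on the last part the enumeration is that of all compositions of `suc d`, and
    -- the truncated sum is the full one.
    ≡⟨ Σ-compositions-from 1⁺ d (λ j≤d → Q≈E n (ℕ.≤-trans j≤d d≤n)) m ⟩
  - EP d 1 m
    ≡⟨ cong -_ (newton d m) ⟩
  - (- fromℕ (suc d) * E (suc d) m)
    ≡⟨ neg-neg (fromℕ (suc d)) (E (suc d) m) ⟩
  fromℕ (suc d) * E (suc d) m ∎)
  where
  neg-neg : ∀ a b → - (- a * b) ≡ a * b
  neg-neg = solve-∀ ℚ-ring

proposition20 : (d : ℕ) →
    E d ≈ ∑ (PComSqf d) (λ (δ , sf) → ((-1ℤ ℤ.^ ℓ δ) /⁺ Zδ sf) · Pδ δ)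
proposition20 d m = begin
  E d m
    ≡⟨ Q≈E d ℕ.≤-refl m ⟨
  Σᴸ (compositions d) (λ α → coef α * ∏ α P m)
    ≡⟨ Σᴸ-cong (compositions d) (λ α → cong₂ (λ l q → ((-1ℤ ℤ.^ l) /⁺ Z α) * q)
         (ℕ.+-identityʳ (length α)) (Pδ-⟨⟩¹ α m)) ⟨
  Σᴸ (compositions d) (λ α → ((-1ℤ ℤ.^ ℓ (α ∷ [])) /⁺ Z α) * Pδ (α ∷ []) m)
    ≡⟨ Σᴸ-map (λ α → α ∷ [] , ⟨ α ⟩¹) (compositions d)
         (λ (δ , sf) → ((-1ℤ ℤ.^ ℓ δ) /⁺ Zδ sf) * Pδ δ m) ⟨
  ∑ (PComSqf d) (λ (δ , sf) → ((-1ℤ ℤ.^ ℓ δ) /⁺ Zδ sf) · Pδ δ) m ∎
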